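{- The limit $\overline{\alpha_3} = \lim_{N \to \infty} \frac{g_3(N)}{N}$ exists and satisfies \[0.790470 < \overline{\alpha_3} < 0.791266.\]
   Context: A three-term (rational) geometric progression is a triple $(a, ak, ak^2)$ of positive integers with $k\in\mathbb{Q}$, $k>1$. Such a progression has ratio involving only the primes at most $s$ if $k=u/v$ with $u,v$ positive integers all of whose prime factors are $\le s$. $g_s(N)$ is the cardinality of the largest subset of $\{1,\dots,N\}$ containing no three-term rational geometric progression whose ratio involves only the primes at most $s$. Here $s=3$, i.e. ratios of the form $2^a3^b$ with $a,b\in\mathbb{Z}$. -}

module Defs where

open import Data.Nat using (ℕ; zero; suc; _+_; _*_; _^_)
import Data.Nat
open import Data.Integer using (+_)
open import Data.Fin using (Fin; toℕ)
open import Data.Fin.Subset using (Subset; _∈_; ∣_∣)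
open import Data.Product using (∃; ∃-syntax; _×_; Σ)
open import Data.Rational using (ℚ; _/_; _-_; 0ℚ) renaming (_+_ to _+ℚ_; ∣_∣ to absℚ)
import Data.Rational
open import Relation.Binary.PropositionalEquality using (_≡_)
open import Relation.Nullary using (¬_)

Smooth3 : ℕ → Set
Smooth3 n = ∃[ i ] ∃[ j ] n ≡ 2 ^ i * 3 ^ j

-- (x, y, z) = (a, a k, a k²) with k = u / v > 1, u, v 3-smooth
-- (written multiplicatively: y = x u / v, z = y u / v)
IsGP3 : ℕ → ℕ → ℕ → Set
IsGP3 x y z = ∃[ u ] ∃[ v ]
  (Smooth3 u × Smooth3 v × v Data.Nat.< u × x * u ≡ y * v × y * u ≡ z * v)

-- the element i : Fin N of a subset represents the integer toℕ i + 1 ∈ {1,…,N}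
num : ∀ {N} → Fin N → ℕ
num i = suc (toℕ i)

GPFree3 : ∀ {N} → Subset N → Set
GPFree3 {N} A = (i j l : Fin N) → i ∈ A → j ∈ A → l ∈ A →
  ¬ IsGP3 (num i) (num j) (num l)

IsG3 : ℕ → ℕ → Set
IsG3 N m = (Σ (Subset N) λ A → GPFree3 A × ∣ A ∣ ≡ m)
         × ((A : Subset N) → GPFree3 A → ∣ A ∣ Data.Nat.≤ m)

ratio : (ℕ → ℕ) → ℕ → ℚ
ratio g n = (+ g (suc n)) / suc n

-- the sequence is Cauchy (so the real limit exists)
Cauchy : (ℕ → ℚ) → Set
Cauchy r = (ε : ℚ) → 0ℚ Data.Rational.< ε →
  ∃[ n₀ ] ((m n : ℕ) → n₀ Data.Nat.≤ m → n₀ Data.Nat.≤ n →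
    absℚ (r m - r n) Data.Rational.< ε)

-- the (real) limit L of r satisfies lo < L < hi
-- (given convergence, equivalent to: r is eventually in [lo+δ, hi−δ] for some δ>0)
LimitStrictlyBetween : ℚ → ℚ → (ℕ → ℚ) → Set
LimitStrictlyBetween lo hi r = ∃[ δ ] (0ℚ Data.Rational.< δ ×
  ∃[ n₀ ] ((n : ℕ) → n₀ Data.Nat.≤ n →
    (lo +ℚ δ) Data.Rational.< r n × r n Data.Rational.< (hi - δ)))

{-# OPTIONS --safe #-}
-- Sort the integers by their part b coprime to 6: inside the class { 2ⁱ3ʲb } the geometric progressions
-- in question are the three-term arithmetic progressions of exponent vectors (i , j), and progressions
-- never leave a class. Hence g N = Σ_b f (N / b), with f M the largest size of an AP-free subset of
-- { (i , j) : 2ⁱ3ʲ ≤ M }.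
--
-- Exchanging single classes between optimal sets shows that e n = g n - g (n - 1) depends only on the
-- 3-smooth part of n. So g N = Σ_ij e (2ⁱ3ʲ) ρ (N / 2ⁱ3ʲ), where ρ counts the integers coprime to 6, and
-- cutting the sum at i , j < k costs at most N (2⁻ᵏ + 3⁻ᵏ) + O(1); this gives convergence.
--
-- If AP-free sets among the first n exponent vectors (ordered by 2ⁱ3ʲ) have at most n - Σ_{k<n} d_k
-- elements, then N - g N ≥ Σ d_k ρ (N / s_k) with s_k the k-th 3-smooth number, by comparing prefixes
-- class by class. Such d_k are certified by an exhaustive search up to n = 62; beyond that, the prefix is
-- the bottom row (or left column) together with a translate of a shorter prefix. The lower bound uses
-- explicit AP-free sets, one for each range of N / b.
module Submission where

-- The count ρ enters only through the lower estimate ρ (N / t) ≥ N / (3 t) - 1. Upper estimates of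
-- g come from applying it to complements: to the coefficients 1 - e in the proof of convergence,
-- and to the integers missing from an optimal set in the numerical upper bound. Convergence
-- therefore needs no value of f or e, only that e is 0 or 1 and does not depend on b. Denominators
-- are cleared by 3 · 6ᵏ throughout, and rationals appear only at the very end.
--
-- The comparison of prefixes is a summation by parts: in a list with decreasing 2ⁱ3ʲ the entries
-- reached by a class form a tail, so one inequality per tail controls all classes at once.
--
-- The exhaustive search is evaluated while the proof is checked. Hence a set is coded as a single
-- number in base 1024, and all progressions through a new point are tested by reading two digits.
-- At most 31 points are ever chosen, and 31² < 1024 rules out carries.

open import Defs
open import Data.Nat renaming (_/_ to _div_)
open import Data.Nat.Properties
open import Data.Nat.DivMod hiding (_/_; _div_)
open import Data.Nat.Divisibility using (_∣_; divides; m∣m*n; n∣m*n; m%n≡0⇒n∣m; n∣m⇒m%n≡0; _∣?_; ∣m⇒∣m*n)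
open import Data.Nat.Primality using (Prime; prime?; euclidsLemma)
open import Data.Nat.Coprimality using (Coprime)
open import Data.Nat.Tactic.RingSolver using (solve-∀)
open import Agda.Builtin.Nat using (div-helper; mod-helper)
open import Data.Bool using (Bool; true; false; not; _∧_; _∨_; if_then_else_; T)
open import Data.Empty using (⊥; ⊥-elim)
open import Data.Fin using (Fin; toℕ) renaming (zero to fzero; suc to fsuc)
open import Data.Fin.Subset using (Subset; ∣_∣) renaming (_∈_ to _∈ˢ_)
import Data.Integer as ℤ
import Data.Integer.Properties as ℤ
open import Data.List using (List; []; _∷_; _++_; length; map; filterᵇ; drop)
open import Data.List.Properties using (length-map; length-++)
open import Data.List.Relation.Unary.All using (All; []; _∷_)
import Data.List.Relation.Unary.All as All
open import Data.List.Relation.Unary.All.Properties using (++⁺; map⁺)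
open import Data.Product using (Σ; ∃-syntax; _×_; _,_; proj₁; proj₂)
open import Data.Rational using (_/_)
import Data.Rational as ℚ
import Data.Rational.Properties as ℚ
import Data.Rational.Unnormalised as ℚᵘ
import Data.Rational.Unnormalised.Properties as ℚᵘ
open import Algebra.Properties.Group ℚ.+-0-group using (⁻¹-involutive)
open import Data.Sum using (inj₁; inj₂)
open import Data.Unit using (⊤; tt)
open import Data.Vec using (lookup; tabulate) renaming ([] to []ᵛ; _∷_ to _∷ᵛ_)
open import Data.Vec.Properties using ([]=⇒lookup; lookup⇒[]=; lookup∘tabulate)
open import Function using (_∘_; case_of_)
open import Relation.Binary.Definitions using (tri<; tri≈; tri>)
open import Relation.Binary.PropositionalEquality using (_≡_; _≢_; refl; sym; trans; cong; cong₂; subst; subst₂)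
open import Relation.Nullary using (¬_; yes; no)
open import Relation.Nullary.Decidable using (toWitness)

-- Finite sums

∑ : ℕ → (ℕ → ℕ) → ℕ
∑ zero    f = 0
∑ (suc n) f = ∑ n f + f n

∑-cong : ∀ n {f h : ℕ → ℕ} → (∀ k → k < n → f k ≡ h k) → ∑ n f ≡ ∑ n h
∑-cong zero    eq = refl
∑-cong (suc n) eq = cong₂ _+_ (∑-cong n (λ k k<n → eq k (m<n⇒m<1+n k<n))) (eq n (n<1+n n))

∑-mono : ∀ n {f h : ℕ → ℕ} → (∀ k → k < n → f k ≤ h k) → ∑ n f ≤ ∑ n h
∑-mono zero    le = z≤n
∑-mono (suc n) le = +-mono-≤ (∑-mono n (λ k k<n → le k (m<n⇒m<1+n k<n))) (le n (n<1+n n))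

interchange : ∀ a b c d → (a + b) + (c + d) ≡ (a + c) + (b + d)
interchange = solve-∀

∑-+ : ∀ n f h → ∑ n (λ k → f k + h k) ≡ ∑ n f + ∑ n h
∑-+ zero    f h = refl
∑-+ (suc n) f h = trans (cong (_+ (f n + h n)) (∑-+ n f h)) (interchange (∑ n f) (∑ n h) (f n) (h n))

∑-*ˡ : ∀ n c f → ∑ n (λ k → c * f k) ≡ c * ∑ n f
∑-*ˡ zero    c f = sym (*-zeroʳ c)
∑-*ˡ (suc n) c f = trans (cong (_+ c * f n) (∑-*ˡ n c f)) (sym (*-distribˡ-+ c (∑ n f) (f n)))

∑-*ʳ : ∀ n f c → ∑ n (λ k → f k * c) ≡ ∑ n f * c
∑-*ʳ zero    f c = refl
∑-*ʳ (suc n) f c = trans (cong (_+ f n * c) (∑-*ʳ n f c)) (sym (*-distribʳ-+ c (∑ n f) (f n)))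

∑-zero : ∀ n {f : ℕ → ℕ} → (∀ k → k < n → f k ≡ 0) → ∑ n f ≡ 0
∑-zero zero    z = refl
∑-zero (suc n) z = cong₂ _+_ (∑-zero n (λ k k<n → z k (m<n⇒m<1+n k<n))) (z n (n<1+n n))

∑-swap : ∀ m n (f : ℕ → ℕ → ℕ) → ∑ m (λ i → ∑ n (λ j → f i j)) ≡ ∑ n (λ j → ∑ m (λ i → f i j))
∑-swap zero    n f = sym (∑-zero n (λ _ _ → refl))
∑-swap (suc m) n f = trans (cong (_+ ∑ n (f m)) (∑-swap m n f)) (sym (∑-+ n _ (f m)))

∑-front : ∀ n f → ∑ (suc n) f ≡ f 0 + ∑ n (f ∘ suc)
∑-front zero    f = sym (+-identityʳ (f 0))
∑-front (suc n) f = trans (cong (_+ f (suc n)) (∑-front n f)) (+-assoc (f 0) _ _)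

∑-split : ∀ m n f → ∑ (m + n) f ≡ ∑ m f + ∑ n (λ k → f (m + k))
∑-split m zero    f = trans (cong (λ x → ∑ x f) (+-identityʳ m)) (sym (+-identityʳ _))
∑-split m (suc n) f = trans (cong (λ x → ∑ x f) (+-suc m n))
  (trans (cong (_+ f (m + n)) (∑-split m n f)) (+-assoc (∑ m f) _ _))

∑-range : ∀ {m n} f → m ≤ n → ∑ m f ≤ ∑ n f
∑-range {m} {n} f m≤n = subst (λ x → ∑ m f ≤ ∑ x f) (m+[n∸m]≡n m≤n)
  (≤-trans (m≤m+n _ _) (≤-reflexive (sym (∑-split m (n ∸ m) f))))

⟦_⟧ : Bool → ℕ
⟦ true  ⟧ = 1
⟦ false ⟧ = 0

⟦⟧≤1 : ∀ b → ⟦ b ⟧ ≤ 1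
⟦⟧≤1 true  = s≤s z≤n
⟦⟧≤1 false = z≤n

⟦⟧+not : ∀ b → ⟦ b ⟧ + ⟦ not b ⟧ ≡ 1
⟦⟧+not true  = refl
⟦⟧+not false = refl

true⇒T : ∀ {b} → b ≡ true → T b
true⇒T refl = tt

T⇒true : ∀ {b} → T b → b ≡ true
T⇒true {true} _ = refl

¬T⇒false : ∀ {b} → ¬ T b → b ≡ false
¬T⇒false {true}  ¬t = ⊥-elim (¬t tt)
¬T⇒false {false} _  = refl

≡ᵇ-refl : ∀ n → (n ≡ᵇ n) ≡ true
≡ᵇ-refl n = T⇒true (≡⇒≡ᵇ n n refl)

≢⇒≡ᵇ : ∀ {m n} → m ≢ n → (m ≡ᵇ n) ≡ false
≢⇒≡ᵇ {m} {n} m≢n = ¬T⇒false (m≢n ∘ ≡ᵇ⇒≡ m n)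

≤⇒≤ᵇ≡ : ∀ {m n} → m ≤ n → (m ≤ᵇ n) ≡ true
≤⇒≤ᵇ≡ m≤n = T⇒true (≤⇒≤ᵇ m≤n)

≰⇒≤ᵇ≡ : ∀ {m n} → ¬ m ≤ n → (m ≤ᵇ n) ≡ false
≰⇒≤ᵇ≡ {m} {n} m≰n = ¬T⇒false (m≰n ∘ ≤ᵇ⇒≤ m n)

≤ᵇ≡⇒≤ : ∀ {m n} → (m ≤ᵇ n) ≡ true → m ≤ n
≤ᵇ≡⇒≤ {m} {n} eq = ≤ᵇ⇒≤ m n (true⇒T eq)

T-ext : ∀ {a b} → (T a → T b) → (T b → T a) → a ≡ b
T-ext {true}  {true}  f g = refl
T-ext {true}  {false} f g = ⊥-elim (f tt)
T-ext {false} {true}  f g = ⊥-elim (g tt)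
T-ext {false} {false} f g = refl

∑-δ : ∀ n a (f : ℕ → ℕ) → a < n → ∑ n (λ k → ⟦ k ≡ᵇ a ⟧ * f k) ≡ f a
∑-δ (suc n) a f a<n with a ≟ n
... | yes refl rewrite ≡ᵇ-refl n = trans (cong (_+ (f n + 0))
        (∑-zero n (λ k k<n → cong (λ b → ⟦ b ⟧ * f k) (≢⇒≡ᵇ (<⇒≢ k<n))))) (+-identityʳ (f n))
... | no a≢n rewrite ≢⇒≡ᵇ (a≢n ∘ sym) = trans (+-identityʳ _) (∑-δ n a f (≤∧≢⇒< (s≤s⁻¹ a<n) a≢n))


+-swapʳ : ∀ x y z → x + y + z ≡ x + z + y
+-swapʳ = solve-∀

∑-exchange : ∀ n a {f h : ℕ → ℕ} → a < n → (∀ k → k ≢ a → f k ≡ h k) → ∑ n f + h a ≡ ∑ n h + f a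
∑-exchange (suc n) a {f} {h} a<n eq with a ≟ n
... | yes refl = trans (cong (λ x → x + f n + h n) (∑-cong n (λ k k<n → eq k (<⇒≢ k<n))))
                   (+-swapʳ (∑ n h) (f n) (h n))
... | no a≢n = trans (+-swapʳ (∑ n f) (f n) (h a)) (trans (cong₂ _+_ (∑-exchange n a (≤∧≢⇒< (s≤s⁻¹ a<n) a≢n) eq) (eq n (a≢n ∘ sym))) (+-swapʳ (∑ n h) (f a) (h n)))

∑-below : ∀ n m (f : ℕ → ℕ) → m ≤ n → ∑ n (λ k → ⟦ suc k ≤ᵇ m ⟧ * f k) ≡ ∑ m f
∑-below n m f m≤n = trans (cong (λ x → ∑ x F) (sym (m+[n∸m]≡n m≤n)))
  (trans (∑-split m (n ∸ m) F)
  (trans (cong₂ _+_ (∑-cong m (λ k k<m → trans (cong (λ b → ⟦ b ⟧ * f k) (≤⇒≤ᵇ≡ k<m)) (*-identityˡ (f k))))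
                    (∑-zero (n ∸ m) (λ k _ → cong (λ b → ⟦ b ⟧ * f (m + k)) (≰⇒≤ᵇ≡ {suc (m + k)} {m} (<⇒≱ (s≤s (m≤m+n m k)))))))
  (+-identityʳ _)))
  where F : ℕ → ℕ
        F k = ⟦ suc k ≤ᵇ m ⟧ * f k

-- The factorisation n = 2ⁱ3ʲb with b coprime to 6

rough : ℕ → Bool
rough b = not (b % 2 ≡ᵇ 0) ∧ not (b % 3 ≡ᵇ 0)

∧-true : ∀ {a b} → a ∧ b ≡ true → a ≡ true × b ≡ true
∧-true {true} {true} _ = refl , refl

not-≡ᵇ : ∀ {m n} → not (m ≡ᵇ n) ≡ true → m ≢ n
not-≡ᵇ {m} eq refl rewrite ≡ᵇ-refl m = case eq of λ ()

rough⇒2∤ : ∀ {b} → rough b ≡ true → ¬ 2 ∣ b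
rough⇒2∤ {b} r d = not-≡ᵇ {b % 2} (proj₁ (∧-true r)) (n∣m⇒m%n≡0 b 2 d)

rough⇒3∤ : ∀ {b} → rough b ≡ true → ¬ 3 ∣ b
rough⇒3∤ {b} r d = not-≡ᵇ {b % 3} (proj₂ (∧-true {not (b % 2 ≡ᵇ 0)} r)) (n∣m⇒m%n≡0 b 3 d)

∤⇒rough : ∀ {b} → ¬ 2 ∣ b → ¬ 3 ∣ b → rough b ≡ true
∤⇒rough {b} ¬2 ¬3
  rewrite ≢⇒≡ᵇ {b % 2} {0} (λ e → ¬2 (m%n≡0⇒n∣m b 2 e)) | ≢⇒≡ᵇ {b % 3} {0} (λ e → ¬3 (m%n≡0⇒n∣m b 3 e)) = refl

rough≥1 : ∀ {b} → rough b ≡ true → 1 ≤ b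
rough≥1 {suc b} _ = s≤s z≤n

smooth : ℕ → ℕ → ℕ
smooth i j = 2 ^ i * 3 ^ j

s≥1 : ∀ i j → 1 ≤ smooth i j
s≥1 i j = *-mono-≤ (m^n>0 2 i) (m^n>0 3 j)

s-+ : ∀ i j k l → smooth i j * smooth k l ≡ smooth (i + k) (j + l)
s-+ i j k l = trans ([m*n]*[o*p]≡[m*o]*[n*p] (2 ^ i) (3 ^ j) (2 ^ k) (3 ^ l))
  (cong₂ _*_ (sym (^-distribˡ-+-* 2 i k)) (sym (^-distribˡ-+-* 3 j l)))

prime2 : Prime 2
prime2 = toWitness {a? = prime? 2} tt

∤-^ : ∀ {p q} → Prime p → ¬ p ∣ q → ∀ k → ¬ p ∣ 1 → ¬ p ∣ q ^ k
∤-^ pr p∤q zero    p∤1 d = p∤1 d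
∤-^ {p} {q} pr p∤q (suc k) p∤1 d with euclidsLemma q (q ^ k) pr d
... | inj₁ d′ = p∤q d′
... | inj₂ d′ = ∤-^ pr p∤q k p∤1 d′

2∤odd : ∀ j {b} → ¬ 2 ∣ b → ¬ 2 ∣ 3 ^ j * b
2∤odd j {b} ¬2 d with euclidsLemma (3 ^ j) b prime2 d
... | inj₁ d′ = ∤-^ prime2 (λ e → case n∣m⇒m%n≡0 3 2 e of λ ()) j (λ e → case n∣m⇒m%n≡0 1 2 e of λ ()) d′
... | inj₂ d′ = ¬2 d′

power-unique : ∀ p .{{_ : NonZero p}} {m n} → ¬ p ∣ m → ¬ p ∣ n → ∀ i j → p ^ i * m ≡ p ^ j * n → i ≡ j × m ≡ n
power-unique p {m} {n} ¬m ¬n zero    zero    eq = refl , trans (sym (*-identityˡ m)) (trans eq (*-identityˡ n))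
power-unique p {m} {n} ¬m ¬n zero    (suc j) eq = ⊥-elim (¬m (subst (p ∣_) (trans (sym eq) (*-identityˡ m)) (∣m⇒∣m*n n (m∣m*n (p ^ j)))))
power-unique p {m} {n} ¬m ¬n (suc i) zero    eq = ⊥-elim (¬n (subst (p ∣_) (trans eq (*-identityˡ n)) (∣m⇒∣m*n m (m∣m*n (p ^ i)))))
power-unique p {m} {n} ¬m ¬n (suc i) (suc j) eq
  with power-unique p ¬m ¬n i j (*-cancelˡ-≡ _ _ p (trans (sym (*-assoc p (p ^ i) m)) (trans eq (*-assoc p (p ^ j) n))))
... | refl , m≡n = refl , m≡n

parts-unique : ∀ {i j b i′ j′ b′} → rough b ≡ true → rough b′ ≡ true →
  smooth i j * b ≡ smooth i′ j′ * b′ → i ≡ i′ × j ≡ j′ × b ≡ b′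
parts-unique {i} {j} {b} {i′} {j′} {b′} r r′ eq
  with power-unique 2 (2∤odd j (rough⇒2∤ r)) (2∤odd j′ (rough⇒2∤ r′)) i i′
         (trans (sym (*-assoc (2 ^ i) (3 ^ j) b)) (trans eq (*-assoc (2 ^ i′) (3 ^ j′) b′)))
... | refl , eq₂ with power-unique 3 (rough⇒3∤ r) (rough⇒3∤ r′) j j′ eq₂
... | refl , eq₃ = refl , refl , eq₃

s-unique : ∀ {i j i′ j′} → smooth i j ≡ smooth i′ j′ → i ≡ i′ × j ≡ j′
s-unique {i} {j} {i′} {j′} eq with parts-unique {i} {j} {1} {i′} {j′} {1} refl refl (cong (_* 1) eq)
... | p , q , _ = p , q

record Parts (n : ℕ) : Set where
  constructor mkParts
  field
    v₂ v₃ core : ℕ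
    core-rough : rough core ≡ true
    parts-≡    : n ≡ smooth v₂ v₃ * core

half< : ∀ {q} k → 1 ≤ q → q < q * suc (suc k)
half< {suc q} k _ = subst (suc q <_) (*-comm (2 + k) (suc q)) (m<m+n (suc q) (s≤s z≤n))

-- The fuel bounds `n`, which makes the repeated division by 2 and 3 structurally recursive.
partsFuel : ∀ f n → n ≤ f → 1 ≤ n → Parts n
partsFuel zero    zero    _ ()
partsFuel (suc f) n n≤f 1≤n with 2 ∣? n | 3 ∣? n
... | yes (divides zero refl) | _ = case 1≤n of λ ()
... | yes (divides (suc q) refl) | _ =
  let mkParts i j b r eq = partsFuel f (suc q) (s≤s⁻¹ (≤-trans (half< {suc q} 0 (s≤s z≤n)) n≤f)) (s≤s z≤n)
  in mkParts (suc i) j b r (trans (*-comm (suc q) 2) (trans (cong (2 *_) eq)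
       (trans (sym (*-assoc 2 (smooth i j) b)) (cong (_* b) (sym (*-assoc 2 (2 ^ i) (3 ^ j)))))))
... | no _ | yes (divides zero refl) = case 1≤n of λ ()
... | no _ | yes (divides (suc q) refl) =
  let mkParts i j b r eq = partsFuel f (suc q) (s≤s⁻¹ (≤-trans (half< {suc q} 1 (s≤s z≤n)) n≤f)) (s≤s z≤n)
  in mkParts i (suc j) b r (trans (cong (_* 3) eq) (pull (2 ^ i) (3 ^ j) b))
  where pull : ∀ x y b → x * y * b * 3 ≡ x * (3 * y) * b
        pull = solve-∀
... | no ¬2 | no ¬3 = mkParts 0 0 n (∤⇒rough ¬2 ¬3) (sym (*-identityˡ n))

abstract
  parts : ∀ n → Parts (suc n)
  parts n = partsFuel (suc n) (suc n) ≤-refl (s≤s z≤n)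

parts-s : ∀ {i j b} n → suc n ≡ smooth i j * b → rough b ≡ true →
  Parts.v₂ (parts n) ≡ i × Parts.v₃ (parts n) ≡ j × Parts.core (parts n) ≡ b
parts-s {i} {j} {b} n eq r = let mkParts i′ j′ b′ r′ eq′ = parts n in
  parts-unique {i′} {j′} {b′} {i} {j} {b} r′ r (trans (sym eq′) eq)

i<2^i : ∀ i → i < 2 ^ i
i<2^i zero    = s≤s z≤n
i<2^i (suc i) = ≤-trans (+-mono-≤ (≤-trans (s≤s z≤n) (i<2^i i)) (i<2^i i))
  (≤-reflexive (cong (2 ^ i +_) (sym (+-identityʳ (2 ^ i)))))

2^≤3^ : ∀ k → 2 ^ k ≤ 3 ^ k
2^≤3^ k = ^-monoˡ-≤ k (s≤s (s≤s (z≤n {1})))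

i<s*b : ∀ i j b → 1 ≤ b → i < smooth i j * b
i<s*b i j b 1≤b = ≤-trans (i<2^i i) (≤-trans (m≤m*n (2 ^ i) (3 ^ j) {{m^n≢0 3 j}}) (m≤m*n (smooth i j) b {{>-nonZero 1≤b}}))

j<s*b : ∀ i j b → 1 ≤ b → j < smooth i j * b
j<s*b i j b 1≤b = ≤-trans (i<2^i j) (≤-trans (2^≤3^ j) (≤-trans (m≤n*m (3 ^ j) (2 ^ i) {{m^n≢0 2 i}}) (m≤m*n (smooth i j) b {{>-nonZero 1≤b}})))

b≤s*b : ∀ i j b → b ≤ smooth i j * b
b≤s*b i j b = m≤n*m b (smooth i j) {{>-nonZero (s≥1 i j)}}

-- One range `D` serves for all three coordinates, since `i`, `j` and `b` are all below
-- `smooth i j * suc b`; in `decompose` the cut at `N` makes a larger range harmless.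
∑³ : ℕ → (ℕ → ℕ → ℕ → ℕ) → ℕ
∑³ D f = ∑ D (λ i → ∑ D (λ j → ∑ D (f i j)))

∑³-cong : ∀ D {f h : ℕ → ℕ → ℕ → ℕ} → (∀ i j b → f i j b ≡ h i j b) → ∑³ D f ≡ ∑³ D h
∑³-cong D eq = ∑-cong D (λ i _ → ∑-cong D (λ j _ → ∑-cong D (λ b _ → eq i j b)))

∑³-swap : ∀ D N (f : ℕ → ℕ → ℕ → ℕ → ℕ) →
  ∑³ D (λ i j b → ∑ N (f i j b)) ≡ ∑ N (λ k → ∑³ D (λ i j b → f i j b k))
∑³-swap D N f = trans
  (∑-cong D (λ i _ → trans (∑-cong D (λ j _ → ∑-swap D N (f i j))) (∑-swap D N _)))
  (∑-swap D N _)

∑-indicator : ∀ N m (φ : ℕ → ℕ) → 1 ≤ m → ⟦ m ≤ᵇ N ⟧ * φ m ≡ ∑ N (λ k → ⟦ suc k ≡ᵇ m ⟧ * φ (suc k))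
∑-indicator N (suc m) φ _ with suc m ≤? N
... | yes m<N rewrite ≤⇒≤ᵇ≡ m<N = trans (*-identityˡ _) (sym (∑-δ N m (φ ∘ suc) m<N))
... | no m≮N rewrite ≰⇒≤ᵇ≡ m≮N = sym (∑-zero N (λ k k<N → cong (λ x → ⟦ x ⟧ * φ (suc k)) (≢⇒≡ᵇ {k} {m} (λ { refl → m≮N k<N }))))

∑³-δ : ∀ D i₀ j₀ b₀ c → i₀ < D → j₀ < D → b₀ < D →
  ∑³ D (λ i j b → ⟦ i ≡ᵇ i₀ ⟧ * (⟦ j ≡ᵇ j₀ ⟧ * (⟦ b ≡ᵇ b₀ ⟧ * c))) ≡ c
∑³-δ D i₀ j₀ b₀ c i< j< b< = trans
  (∑-cong D (λ i _ → trans (∑-cong D (λ j _ → trans (∑-*ˡ D ⟦ i ≡ᵇ i₀ ⟧ _) (cong (⟦ i ≡ᵇ i₀ ⟧ *_) (trans (∑-*ˡ D ⟦ j ≡ᵇ j₀ ⟧ _) (cong (⟦ j ≡ᵇ j₀ ⟧ *_) (∑-δ D b₀ (λ _ → c) b<))))))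
    (trans (∑-*ˡ D ⟦ i ≡ᵇ i₀ ⟧ _) (cong (⟦ i ≡ᵇ i₀ ⟧ *_) (∑-δ D j₀ (λ _ → c) j<)))))
  (∑-δ D i₀ (λ _ → c) i<)

vanish : ∀ k c i j b → (rough (suc b) ≡ true → suc k ≡ smooth i j * suc b → ⊥) →
  ⟦ rough (suc b) ⟧ * (⟦ suc k ≡ᵇ smooth i j * suc b ⟧ * c) ≡ 0
vanish k c i j b impossible with rough (suc b)
... | false = refl
... | true rewrite ≢⇒≡ᵇ (impossible refl) = refl

indicator-parts : ∀ k c i₀ j₀ b₀ → rough (suc b₀) ≡ true → suc k ≡ smooth i₀ j₀ * suc b₀ → ∀ i j b →
  ⟦ rough (suc b) ⟧ * (⟦ suc k ≡ᵇ smooth i j * suc b ⟧ * c) ≡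
  ⟦ i ≡ᵇ i₀ ⟧ * (⟦ j ≡ᵇ j₀ ⟧ * (⟦ b ≡ᵇ b₀ ⟧ * c))
indicator-parts k c i₀ j₀ b₀ r₀ eq i j b with i ≟ i₀ | j ≟ j₀ | b ≟ b₀
... | yes refl | yes refl | yes refl
  rewrite r₀ | sym eq | ≡ᵇ-refl k | ≡ᵇ-refl i | ≡ᵇ-refl j | ≡ᵇ-refl b = sym (+-identityʳ _)
... | no i≢ | _ | _ rewrite ≢⇒≡ᵇ i≢ = vanish k c i j b λ r e →
  i≢ (proj₁ (parts-unique {i} {j} {_} {i₀} {j₀} r r₀ (trans (sym e) eq)))
... | yes _ | no j≢ | _ rewrite ≢⇒≡ᵇ j≢ | *-zeroʳ ⟦ i ≡ᵇ i₀ ⟧ = vanish k c i j b λ r e →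
  j≢ (proj₁ (proj₂ (parts-unique {i} {j} {_} {i₀} {j₀} r r₀ (trans (sym e) eq))))
... | yes _ | yes _ | no b≢ rewrite ≢⇒≡ᵇ b≢ | *-zeroʳ ⟦ j ≡ᵇ j₀ ⟧ | *-zeroʳ ⟦ i ≡ᵇ i₀ ⟧ = vanish k c i j b λ r e →
  b≢ (suc-injective (proj₂ (proj₂ (parts-unique {i} {j} {_} {i₀} {j₀} r r₀ (trans (sym e) eq)))))

-- Every positive integer is 2ⁱ3ʲb with b coprime to 6 in exactly one way.
decompose : ∀ D N (φ : ℕ → ℕ) → N ≤ D → ∑ N (λ k → φ (suc k)) ≡
  ∑³ D (λ i j b → ⟦ rough (suc b) ⟧ * (⟦ smooth i j * suc b ≤ᵇ N ⟧ * φ (smooth i j * suc b)))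
decompose D N φ N≤D = sym (trans
  (∑³-cong D (λ i j b → trans
    (cong (⟦ rough (suc b) ⟧ *_) (∑-indicator N (smooth i j * suc b) φ (*-mono-≤ (s≥1 i j) (s≤s z≤n))))
    (sym (∑-*ˡ N ⟦ rough (suc b) ⟧ _))))
  (trans (∑³-swap D N _) (∑-cong N single)))
  where
  single : ∀ k → k < N → ∑³ D (λ i j b → ⟦ rough (suc b) ⟧ * (⟦ suc k ≡ᵇ smooth i j * suc b ⟧ * φ (suc k))) ≡ φ (suc k)
  single k k<N with parts k
  ... | mkParts i₀ j₀ zero r eq = case r of λ ()
  ... | mkParts i₀ j₀ (suc b₀) r eq = trans
    (∑³-cong D (indicator-parts k (φ (suc k)) i₀ j₀ b₀ r eq))
    (∑³-δ D i₀ j₀ b₀ (φ (suc k))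
      (≤-trans (i<s*b i₀ j₀ (suc b₀) (s≤s z≤n)) n≤D)
      (≤-trans (j<s*b i₀ j₀ (suc b₀) (s≤s z≤n)) n≤D)
      (≤-trans (b≤s*b i₀ j₀ (suc b₀)) n≤D))
    where n≤D : smooth i₀ j₀ * suc b₀ ≤ D
          n≤D = ≤-trans (≤-reflexive (sym eq)) (≤-trans k<N N≤D)

-- Classes and progression-free sets

-- No direction is fixed, as the equations are symmetric in the end points; only the constant
-- progression is allowed.
APFree : (ℕ → ℕ → Bool) → Set
APFree C = ∀ i₁ j₁ i₂ j₂ i₃ j₃ → C i₁ j₁ ≡ true → C i₂ j₂ ≡ true → C i₃ j₃ ≡ true →
  i₁ + i₃ ≡ i₂ + i₂ → j₁ + j₃ ≡ j₂ + j₂ → i₁ ≡ i₃ × j₁ ≡ j₃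

-- The set is not tied to an initial segment, so it can be counted both up to `n` and up to `suc n`,
-- and whole classes can move between sets. `fromSubset` is empty beyond `N`.
Free : (ℕ → Bool) → Set
Free X = ∀ x y z → X (suc x) ≡ true → X (suc y) ≡ true → X (suc z) ≡ true → ¬ IsGP3 (suc x) (suc y) (suc z)

class : (ℕ → Bool) → ℕ → ℕ → ℕ → Bool
class X b i j = X (smooth i j * b)

Free-s : ∀ {X b} → 1 ≤ b → Free X → ∀ i j k l m n → class X b i j ≡ true → class X b k l ≡ true → class X b m n ≡ true →
  ¬ IsGP3 (smooth i j * b) (smooth k l * b) (smooth m n * b)
Free-s {X} {b} 1≤b fr i j k l m n with smooth i j * b | smooth k l * b | smooth m n * b | *-mono-≤ (s≥1 i j) 1≤b | *-mono-≤ (s≥1 k l) 1≤b | *-mono-≤ (s≥1 m n) 1≤b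
... | suc x | suc y | suc z | _ | _ | _ = fr x y z

-- The ratio is taken as the unreduced quotient of the first two smooth parts, which avoids negative
-- exponents.
AP-IsGP3 : ∀ b i₁ j₁ i₂ j₂ i₃ j₃ → i₁ + i₃ ≡ i₂ + i₂ → j₁ + j₃ ≡ j₂ + j₂ → smooth i₁ j₁ < smooth i₂ j₂ →
  IsGP3 (smooth i₁ j₁ * b) (smooth i₂ j₂ * b) (smooth i₃ j₃ * b)
AP-IsGP3 b i₁ j₁ i₂ j₂ i₃ j₃ eqi eqj lt = smooth i₂ j₂ , smooth i₁ j₁ , (i₂ , j₂ , refl) , (i₁ , j₁ , refl) , lt ,
  rot (smooth i₁ j₁) b (smooth i₂ j₂) ,
  trans (swapʳ (smooth i₂ j₂) b (smooth i₂ j₂)) (trans (cong (_* b) mid) (sym (swapʳ′ (smooth i₃ j₃) b (smooth i₁ j₁))))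
  where
  rot : ∀ x b y → x * b * y ≡ y * b * x
  rot = solve-∀
  swapʳ : ∀ x b y → x * b * y ≡ x * y * b
  swapʳ = solve-∀
  swapʳ′ : ∀ x b y → x * b * y ≡ y * x * b
  swapʳ′ = solve-∀
  mid : smooth i₂ j₂ * smooth i₂ j₂ ≡ smooth i₁ j₁ * smooth i₃ j₃
  mid = trans (s-+ i₂ j₂ i₂ j₂) (trans (cong₂ smooth (sym eqi) (sym eqj)) (sym (s-+ i₁ j₁ i₃ j₃)))

double-injective : ∀ {a b} → a + a ≡ b + b → a ≡ b
double-injective {a} {b} eq = *-cancelˡ-≡ a b 2 (trans (cong (a +_) (+-identityʳ a)) (trans eq (sym (cong (b +_) (+-identityʳ b)))))

-- Read from an end smaller than the middle, the progression of exponents is geometric with ratio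
-- above 1. Two ends larger than the middle contradict s₁ s₃ = s₂², and an end equal to the middle
-- makes it constant.
class-APFree : ∀ {X b} → 1 ≤ b → Free X → APFree (class X b)
class-APFree {X} {b} 1≤b fr i₁ j₁ i₂ j₂ i₃ j₃ c₁ c₂ c₃ eqi eqj with <-cmp (smooth i₁ j₁) (smooth i₂ j₂) | <-cmp (smooth i₃ j₃) (smooth i₂ j₂)
... | tri< lt _ _ | _ = ⊥-elim (Free-s {X} 1≤b fr i₁ j₁ i₂ j₂ i₃ j₃ c₁ c₂ c₃ (AP-IsGP3 b i₁ j₁ i₂ j₂ i₃ j₃ eqi eqj lt))
... | _ | tri< lt _ _ = ⊥-elim (Free-s {X} 1≤b fr i₃ j₃ i₂ j₂ i₁ j₁ c₃ c₂ c₁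
        (AP-IsGP3 b i₃ j₃ i₂ j₂ i₁ j₁ (trans (+-comm i₃ i₁) eqi) (trans (+-comm j₃ j₁) eqj) lt))
... | tri≈ _ eq _ | tri> _ _ _ = eqCase (s-unique {i₁} {j₁} {i₂} {j₂} eq)
  where eqCase : i₁ ≡ i₂ × j₁ ≡ j₂ → i₁ ≡ i₃ × j₁ ≡ j₃
        eqCase (refl , refl) = sym (+-cancelˡ-≡ i₁ i₃ i₁ eqi) , sym (+-cancelˡ-≡ j₁ j₃ j₁ eqj)
... | tri≈ _ eq _ | tri≈ _ eq′ _ = s-unique {i₁} {j₁} {i₃} {j₃} (trans eq (sym eq′))
... | tri> _ _ gt | tri≈ _ eq _ = eqCase (s-unique {i₃} {j₃} {i₂} {j₂} eq)
  where eqCase : i₃ ≡ i₂ × j₃ ≡ j₂ → i₁ ≡ i₃ × j₁ ≡ j₃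
        eqCase (refl , refl) = +-cancelʳ-≡ i₃ i₁ i₃ eqi , +-cancelʳ-≡ j₃ j₁ j₃ eqj
... | tri> _ _ gt | tri> _ _ gt′ = ⊥-elim (<-irrefl
        (trans (s-+ i₂ j₂ i₂ j₂) (trans (cong₂ smooth (sym eqi) (sym eqj)) (sym (s-+ i₁ j₁ i₃ j₃))))
        (*-mono-< gt gt′))

assemble : (ℕ → ℕ → ℕ → Bool) → ℕ → Bool
assemble C zero    = false
assemble C (suc k) = C (Parts.core (parts k)) (Parts.v₂ (parts k)) (Parts.v₃ (parts k))

assemble-at : ∀ C i j b → rough b ≡ true → assemble C (smooth i j * b) ≡ C b i j
assemble-at C i j zero r = case r of λ ()
assemble-at C i j (suc b) r with smooth i j * suc b in eq | *-mono-≤ (s≥1 i j) (s≤s (z≤n {b}))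
... | suc k | _ with parts-s {i} {j} {suc b} k (sym eq) r
... | ei , ej , eb = trans (cong (λ b → C b (Parts.v₂ (parts k)) (Parts.v₃ (parts k))) eb) (cong₂ (C (suc b)) ei ej)

-- Multiplying by u or v keeps the core and shifts the exponents, so unique factorisation turns x u
-- = y v and y u = z v into an arithmetic progression inside one class.
assemble-Free : ∀ {C} → (∀ b → 1 ≤ b → APFree (C b)) → Free (assemble C)
assemble-Free {C} free x y z cx cy cz (u , v , (a , c , refl) , (a′ , c′ , refl) , v<u , xu , yu)
  with parts x | parts y | parts z
... | mkParts i₁ j₁ b₁ r₁ e₁ | mkParts i₂ j₂ b₂ r₂ e₂ | mkParts i₃ j₃ b₃ r₃ e₃ =
  let p , q , b₁₂ = shifted i₁ j₁ b₁ a c i₂ j₂ b₂ a′ c′ r₁ r₂ (subst₂ (λ x y → x * smooth a c ≡ y * smooth a′ c′) e₁ e₂ xu)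
      p′ , q′ , b₂₃ = shifted i₂ j₂ b₂ a c i₃ j₃ b₃ a′ c′ r₂ r₃ (subst₂ (λ x y → x * smooth a c ≡ y * smooth a′ c′) e₂ e₃ yu)
      i₁₃ , j₁₃ = free b₁ (rough≥1 r₁) i₁ j₁ i₂ j₂ i₃ j₃ cx (subst (λ b → C b i₂ j₂ ≡ true) (sym b₁₂) cy)
                    (subst (λ b → C b i₃ j₃ ≡ true) (sym (trans b₁₂ b₂₃)) cz)
                    (middle i₁ i₂ i₃ a a′ p p′) (middle j₁ j₂ j₃ c c′ q q′)
      x≡z = suc-injective (trans e₁ (trans (cong₂ _*_ (cong₂ smooth i₁₃ j₁₃) (trans b₁₂ b₂₃)) (sym e₃)))
  -- With x = z the two equations add up to (x + y) u = (x + y) v, against v < u.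
  in <-irrefl (sym (*-cancelˡ-≡ (smooth a c) (smooth a′ c′) (suc x + suc y)
       (trans (*-distribʳ-+ (smooth a c) (suc x) (suc y)) (trans (cong₂ _+_ xu (subst (λ z → suc y * smooth a c ≡ suc z * smooth a′ c′) (sym x≡z) yu))
       (trans (+-comm (suc y * smooth a′ c′) _) (sym (*-distribʳ-+ (smooth a′ c′) (suc x) (suc y)))))))) v<u
  where
  shifted : ∀ i j b a c i′ j′ b′ a′ c′ → rough b ≡ true → rough b′ ≡ true →
    smooth i j * b * smooth a c ≡ smooth i′ j′ * b′ * smooth a′ c′ → i + a ≡ i′ + a′ × j + c ≡ j′ + c′ × b ≡ b′
  shifted i j b a c i′ j′ b′ a′ c′ r r′ eq = parts-unique {i + a} {j + c} {b} {i′ + a′} {j′ + c′} {b′} r r′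
    (trans (gather i j b a c) (trans eq (sym (gather i′ j′ b′ a′ c′))))
    where gather : ∀ i j b a c → smooth (i + a) (j + c) * b ≡ smooth i j * b * smooth a c
          gather i j b a c = trans (cong (_* b) (sym (s-+ i j a c))) (swapʳ (smooth i j) (smooth a c) b)
            where swapʳ : ∀ x y b → x * y * b ≡ x * b * y
                  swapʳ = solve-∀
  middle : ∀ i₁ i₂ i₃ a a′ → i₁ + a ≡ i₂ + a′ → i₂ + a ≡ i₃ + a′ → i₁ + i₃ ≡ i₂ + i₂
  middle i₁ i₂ i₃ a a′ p q = +-cancelʳ-≡ (a + a′) (i₁ + i₃) (i₂ + i₂)
    (trans (h₁ i₁ i₃ a a′) (trans (cong₂ _+_ p (sym q)) (h₂ i₂ a a′)))
    where h₁ : ∀ i₁ i₃ a a′ → i₁ + i₃ + (a + a′) ≡ (i₁ + a) + (i₃ + a′)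
          h₁ = solve-∀
          h₂ : ∀ i a a′ → (i + a′) + (i + a) ≡ i + i + (a + a′)
          h₂ = solve-∀

cnt : (ℕ → Bool) → ℕ → ℕ
cnt X N = ∑ N (λ k → ⟦ X (suc k) ⟧)

member : ∀ {N} → Subset N → ℕ → Bool
member []ᵛ       _       = false
member (x ∷ᵛ xs) zero    = x
member (x ∷ᵛ xs) (suc k) = member xs k

fromSubset : ∀ {N} → Subset N → ℕ → Bool
fromSubset A zero    = false
fromSubset A (suc k) = member A k

member⇒∈ : ∀ {N} (A : Subset N) k → member A k ≡ true → Σ (Fin N) λ f → toℕ f ≡ k × lookup A f ≡ true
member⇒∈ (x ∷ᵛ xs) zero    m = fzero , refl , m
member⇒∈ (x ∷ᵛ xs) (suc k) m = let f , e , l = member⇒∈ xs k m in fsuc f , cong suc e , l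

∣∣-member : ∀ {N} (A : Subset N) → ∣ A ∣ ≡ ∑ N (λ k → ⟦ member A k ⟧)
∣∣-member []ᵛ = refl
∣∣-member {suc N} (true ∷ᵛ xs)  = trans (cong suc (∣∣-member xs)) (sym (∑-front N _))
∣∣-member {suc N} (false ∷ᵛ xs) = trans (∣∣-member xs) (sym (∑-front N _))

member-tabulate : ∀ N (X : ℕ → Bool) k → k < N → member (tabulate {n = N} (X ∘ toℕ)) k ≡ X k
member-tabulate (suc N) X zero    _         = refl
member-tabulate (suc N) X (suc k) (s≤s k<N) = member-tabulate N (X ∘ suc) k k<N

fromSubset-Free : ∀ {N} {A : Subset N} → GPFree3 A → Free (fromSubset A)
fromSubset-Free {N} {A} free x y z mx my mz gp with member⇒∈ A x mx | member⇒∈ A y my | member⇒∈ A z mz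
... | f₁ , refl , l₁ | f₂ , refl , l₂ | f₃ , refl , l₃ =
  free f₁ f₂ f₃ (lookup⇒[]= f₁ A l₁) (lookup⇒[]= f₂ A l₂) (lookup⇒[]= f₃ A l₃) gp

toSubset : (ℕ → Bool) → ∀ N → Subset N
toSubset X N = tabulate (X ∘ num)

toSubset-GPFree : ∀ {X} N → Free X → GPFree3 (toSubset X N)
toSubset-GPFree {X} N free i j l i∈ j∈ l∈ = free (toℕ i) (toℕ j) (toℕ l) (holds i i∈) (holds j j∈) (holds l l∈)
  where holds : ∀ i → i ∈ˢ toSubset X N → X (num i) ≡ true
        holds i i∈ = trans (sym (lookup∘tabulate (X ∘ num) i)) ([]=⇒lookup i∈)

∣toSubset∣ : ∀ X N → ∣ toSubset X N ∣ ≡ cnt X N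
∣toSubset∣ X N = trans (∣∣-member (toSubset X N)) (∑-cong N (λ k k<N → cong ⟦_⟧ (member-tabulate N (X ∘ suc) k k<N)))

record Optimum (N m : ℕ) : Set where
  field
    set  : ℕ → Bool
    free : Free set
    size : cnt set N ≡ m

module _ {N m} (opt : IsG3 N m) where

  optimum : Optimum N m
  optimum = let (A , free , size) , _ = opt in record
    { set = fromSubset A ; free = fromSubset-Free free ; size = trans (sym (∣∣-member A)) size }

  maximal : ∀ X → Free X → cnt X N ≤ m
  maximal X free = subst (_≤ m) (∣toSubset∣ X N) (proj₂ opt (toSubset X N) (toSubset-GPFree {X} N free))

-- Exchanging classes

grid : ℕ → (ℕ → ℕ → ℕ) → ℕ
grid D f = ∑ D (λ i → ∑ D (f i))

grid-cong : ∀ D {f h : ℕ → ℕ → ℕ} → (∀ i j → i < D → j < D → f i j ≡ h i j) → grid D f ≡ grid D h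
grid-cong D eq = ∑-cong D (λ i i<D → ∑-cong D (λ j j<D → eq i j i<D j<D))

grid-mono : ∀ D {f h : ℕ → ℕ → ℕ} → (∀ i j → i < D → j < D → f i j ≤ h i j) → grid D f ≤ grid D h
grid-mono D le = ∑-mono D (λ i i<D → ∑-mono D (λ j j<D → le i j i<D j<D))

grid-*ˡ : ∀ D c f → grid D (λ i j → c * f i j) ≡ c * grid D f
grid-*ˡ D c f = trans (∑-cong D (λ i _ → ∑-*ˡ D c (f i))) (∑-*ˡ D c _)

grid-+ : ∀ D f h → grid D (λ i j → f i j + h i j) ≡ grid D f + grid D h
grid-+ D f h = trans (∑-cong D (λ i _ → ∑-+ D (f i) (h i))) (∑-+ D _ _)

grid-range : ∀ {m n} f → m ≤ n → grid m f ≤ grid n f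
grid-range {m} {n} f m≤n = ≤-trans (∑-mono m (λ i _ → ∑-range (f i) m≤n)) (∑-range (λ i → ∑ n (f i)) m≤n)

grid-∑ : ∀ D n (f : ℕ → ℕ → ℕ → ℕ) → grid D (λ i j → ∑ n (f i j)) ≡ ∑ n (λ b → grid D (λ i j → f i j b))
grid-∑ D n f = trans (∑-cong D (λ i _ → ∑-swap D n (f i))) (∑-swap D n _)

-- For N ≤ D and `b` coprime to 6, this is the part of φ 1 + ... + φ N that comes from the class of
-- `b`.
slice : (ℕ → ℕ) → ℕ → ℕ → ℕ → ℕ
slice φ D N b = grid D (λ i j → ⟦ smooth i j * b ≤ᵇ N ⟧ * φ (smooth i j * b))

by-class : ∀ D N φ → N ≤ D → ∑ N (λ k → φ (suc k)) ≡ ∑ D (λ b → ⟦ rough (suc b) ⟧ * slice φ D N (suc b))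
by-class D N φ N≤D = trans (decompose D N φ N≤D)
  (trans (grid-∑ D D _) (∑-cong D (λ b _ → grid-*ˡ D ⟦ rough (suc b) ⟧ _)))

if-yes : ∀ {A : Set} n {x y : A} → (if n ≡ᵇ n then x else y) ≡ x
if-yes n rewrite ≡ᵇ-refl n = refl

if-no : ∀ {A : Set} {m n} {x y : A} → m ≢ n → (if m ≡ᵇ n then x else y) ≡ y
if-no {m = m} {n} m≢n rewrite ≢⇒≡ᵇ {m} {n} m≢n = refl

replace : (ℕ → Bool) → ℕ → (ℕ → ℕ → Bool) → ℕ → Bool
replace X b C = assemble (λ b′ → if b′ ≡ᵇ b then C else class X b′)

replace-Free : ∀ {X C} b → Free X → APFree C → Free (replace X b C)
replace-Free {X} {C} b freeX freeC = assemble-Free lemma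
  where
  lemma : ∀ b′ → 1 ≤ b′ → APFree (if b′ ≡ᵇ b then C else class X b′)
  lemma b′ 1≤b′ with b′ ≡ᵇ b
  ... | true  = freeC
  ... | false = class-APFree {X} 1≤b′ freeX

replace-at : ∀ X C {b} → rough b ≡ true → ∀ i j → replace X b C (smooth i j * b) ≡ C i j
replace-at X C {b} r i j = trans (assemble-at _ i j b r) (cong (λ (f : ℕ → ℕ → Bool) → f i j) (if-yes b {C} {class X b}))

replace-other : ∀ X C {b b′} → rough b′ ≡ true → b′ ≢ b → ∀ i j → replace X b C (smooth i j * b′) ≡ X (smooth i j * b′)
replace-other X C {b} {b′} r b′≢b i j = trans (assemble-at _ i j b′ r) (cong (λ (f : ℕ → ℕ → Bool) → f i j) (if-no {m = b′} {b} {C} {class X b′} b′≢b))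

ind : (ℕ → Bool) → ℕ → ℕ
ind X n = ⟦ X n ⟧

-- In the expansion `by-class` only the summand of `suc b` changes. The additive form avoids
-- truncated subtraction.
cnt-replace : ∀ X C b D N → rough (suc b) ≡ true → b < D → N ≤ D →
  cnt (replace X (suc b) C) N + slice (ind X) D N (suc b) ≡
  cnt X N + slice (ind (replace X (suc b) C)) D N (suc b)
cnt-replace X C b D N r b<D N≤D = subst₂ (λ x y → x + slice (ind X) D N (suc b) ≡ y + slice (ind X′) D N (suc b))
  (sym (by-class D N (ind X′) N≤D)) (sym (by-class D N (ind X) N≤D))
  (subst₂ (λ x y → ∑ D (term (ind X′)) + x ≡ ∑ D (term (ind X)) + y) (unit (ind X)) (unit (ind X′))
    (∑-exchange D b b<D agree))
  where
  X′ : ℕ → Bool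
  X′ = replace X (suc b) C
  term : (ℕ → ℕ) → ℕ → ℕ
  term φ k = ⟦ rough (suc k) ⟧ * slice φ D N (suc k)
  unit : ∀ φ → ⟦ rough (suc b) ⟧ * slice φ D N (suc b) ≡ slice φ D N (suc b)
  unit φ rewrite r = *-identityˡ _
  agree : ∀ k → k ≢ b → ⟦ rough (suc k) ⟧ * slice (ind X′) D N (suc k) ≡ ⟦ rough (suc k) ⟧ * slice (ind X) D N (suc k)
  agree k k≢b with rough (suc k) in rk
  ... | false = refl
  ... | true  = cong (1 *_) (grid-cong D (λ i j _ _ → cong (λ x → ⟦ smooth i j * suc k ≤ᵇ N ⟧ * ⟦ x ⟧)
                  (replace-other X C rk (k≢b ∘ suc-injective) i j)))

-- Both tests say 2ⁱ3ʲ < 2^i₀ 3^j₀: just below such a threshold, the class of `suc b` and the class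
-- of 1 show the same exponent vectors.
class-threshold : ∀ {b n m i₀ j₀} → smooth i₀ j₀ ≡ suc m → smooth i₀ j₀ * suc b ≡ suc n → ∀ i j → (smooth i j * suc b ≤ᵇ n) ≡ (smooth i j * 1 ≤ᵇ m)
class-threshold {b} {n} {m} {i₀} {j₀} eqm eqn i j = T-ext
  (λ t → ≤⇒≤ᵇ (≤-trans (≤-reflexive (*-identityʳ (smooth i j))) (s≤s⁻¹ (subst (smooth i j <_) eqm
    (*-cancelʳ-< (suc b) (smooth i j) (smooth i₀ j₀) (subst (smooth i j * suc b <_) (sym eqn) (s≤s (≤ᵇ⇒≤ (smooth i j * suc b) n t))))))))
  (λ t → ≤⇒≤ᵇ (s≤s⁻¹ (subst (smooth i j * suc b <_) eqn (*-monoˡ-< (suc b) (subst (smooth i j <_) (sym eqm)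
    (s≤s (≤-trans (≤-reflexive (sym (*-identityʳ (smooth i j)))) (≤ᵇ⇒≤ (smooth i j * 1) m t))))))))

slice-replace : ∀ X Y b D {n m i₀ j₀} → rough (suc b) ≡ true → smooth i₀ j₀ ≡ suc m → smooth i₀ j₀ * suc b ≡ suc n →
  slice (ind (replace X (suc b) (class Y 1))) D n (suc b) ≡ slice (ind Y) D m 1
slice-replace X Y b D {i₀ = i₀} {j₀} r eqm eqn = grid-cong D (λ i j _ _ →
  cong₂ (λ x y → ⟦ x ⟧ * ⟦ y ⟧) (class-threshold {i₀ = i₀} {j₀} eqm eqn i j) (replace-at X (class Y 1) r i j))

slice-replace₁ : ∀ X Y b D {n m i₀ j₀} → smooth i₀ j₀ ≡ suc m → smooth i₀ j₀ * suc b ≡ suc n →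
  slice (ind (replace Y 1 (class X (suc b)))) D m 1 ≡ slice (ind X) D n (suc b)
slice-replace₁ X Y b D {i₀ = i₀} {j₀} eqm eqn = grid-cong D (λ i j _ _ →
  cong₂ (λ x y → ⟦ x ⟧ * ⟦ y ⟧) (sym (class-threshold {i₀ = i₀} {j₀} eqm eqn i j)) (replace-at Y (class X (suc b)) refl i j))

-- By `class-threshold` the two classes have the same shape below `n` and `m`, so the sets merely
-- trade these slices.
cnt-swap : ∀ X Y b {n m i₀ j₀} → rough (suc b) ≡ true → smooth i₀ j₀ ≡ suc m → smooth i₀ j₀ * suc b ≡ suc n →
  cnt (replace X (suc b) (class Y 1)) n + cnt (replace Y 1 (class X (suc b))) m ≡ cnt X n + cnt Y m
cnt-swap X Y b {n} {m} {i₀} {j₀} r eqm eqn = +-cancelʳ-≡ (slX + slY) _ _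
  (trans (interchange (cnt X′ n) (cnt Y′ m) slX slY)
  (trans (cong₂ _+_
    (trans (cnt-replace X (class Y 1) b (suc n) n r b<D (n≤1+n n)) (cong (cnt X n +_) (slice-replace X Y b (suc n) {i₀ = i₀} {j₀} r eqm eqn)))
    (trans (cnt-replace Y (class X (suc b)) 0 (suc n) m refl (s≤s z≤n) m≤D) (cong (cnt Y m +_) (slice-replace₁ X Y b (suc n) {i₀ = i₀} {j₀} eqm eqn))))
  (trans (interchange (cnt X n) slY (cnt Y m) slX) (cong (cnt X n + cnt Y m +_) (+-comm slY slX)))))
  where
  X′ Y′ : ℕ → Bool
  X′ = replace X (suc b) (class Y 1)
  Y′ = replace Y 1 (class X (suc b))
  slX slY : ℕ
  slX = slice (ind X) (suc n) n (suc b)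
  slY = slice (ind Y) (suc n) m 1
  b<D : b < suc n
  b<D = subst (suc b ≤_) eqn (b≤s*b i₀ j₀ (suc b))
  m≤D : m ≤ suc n
  m≤D = ≤-trans (n≤1+n m) (subst₂ _≤_ eqm eqn (m≤m*n (smooth i₀ j₀) (suc b)))

-- Counting the integers coprime to 6

ρ : ℕ → ℕ → ℕ → ℕ
ρ D N t = ∑ D (λ b → ⟦ rough (suc b) ⟧ * ⟦ t * suc b ≤ᵇ N ⟧)

roughs : ℕ → ℕ
roughs M = ∑ M (λ b → ⟦ rough (suc b) ⟧)

rough-periodic : ∀ b → rough (6 + b) ≡ rough b
rough-periodic b = cong₂ (λ x y → not (x ≡ᵇ 0) ∧ not (y ≡ᵇ 0))
  (trans (cong (_% 2) (+-comm 6 b)) ([m+kn]%n≡m%n b 3 2))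
  (trans (cong (_% 3) (+-comm 6 b)) ([m+kn]%n≡m%n b 2 3))

roughs-step : ∀ M → roughs (6 + M) ≡ 2 + roughs M
roughs-step M = trans (∑-split 6 M _) (cong (2 +_) (∑-cong M (λ b _ → cong ⟦_⟧
  (trans (cong rough (sym (+-suc 6 b))) (rough-periodic (suc b))))))

3+6 : ∀ x → 3 * (2 + x) ≡ 6 + 3 * x
3+6 = solve-∀

-- Two residues out of six are coprime to 6, hence induction in steps of 6. The 2 here and the
-- remainder of the division by `t` make up the error 3 t in `ρ-lower`.
≤3*roughs+2 : ∀ M → M ≤ 3 * roughs M + 2
≤3*roughs+2 0 = z≤n
≤3*roughs+2 1 = s≤s z≤n
≤3*roughs+2 2 = s≤s (s≤s z≤n)
≤3*roughs+2 3 = s≤s (s≤s (s≤s z≤n))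
≤3*roughs+2 4 = s≤s (s≤s (s≤s (s≤s z≤n)))
≤3*roughs+2 5 = s≤s (s≤s (s≤s (s≤s (s≤s z≤n))))
≤3*roughs+2 (suc (suc (suc (suc (suc (suc M)))))) =
  subst (λ x → 6 + M ≤ x + 2) (sym (trans (cong (3 *_) (roughs-step M)) (3+6 (roughs M))))
    (+-monoʳ-≤ 6 (≤3*roughs+2 M))

ρ-roughs : ∀ D N t .{{_ : NonZero t}} → N ≤ D → ρ D N t ≡ roughs (N div t)
ρ-roughs D N t N≤D = trans
  (∑-cong D (λ b _ → trans (*-comm ⟦ rough (suc b) ⟧ _) (cong (λ x → ⟦ x ⟧ * ⟦ rough (suc b) ⟧) (threshold b))))
  (∑-below D (N div t) (λ b → ⟦ rough (suc b) ⟧) (≤-trans (m/n≤m N t) N≤D))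
  where
  threshold : ∀ b → (t * suc b ≤ᵇ N) ≡ (suc b ≤ᵇ N div t)
  threshold b = T-ext
    (λ h → ≤⇒≤ᵇ {suc b} (subst (_≤ N div t) (m*n/n≡m (suc b) t) (/-monoˡ-≤ t (≤-trans (≤-reflexive (*-comm (suc b) t)) (≤ᵇ⇒≤ (t * suc b) N h)))))
    (λ h → ≤⇒≤ᵇ (≤-trans (*-monoʳ-≤ t (≤ᵇ⇒≤ (suc b) (N div t) h)) (≤-trans (≤-reflexive (*-comm t (N div t))) (m/n*n≤m N t))))

ρ-lower : ∀ D N t .{{_ : NonZero t}} → N ≤ D → N ≤ 3 * t * ρ D N t + 3 * t
ρ-lower D N t N≤D rewrite ρ-roughs D N t N≤D = ≤-trans (≤-reflexive (m≡m%n+[m/n]*n N t))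
  (≤-trans (+-mono-≤ (<⇒≤ (m%n<n N t)) (*-monoˡ-≤ t (≤3*roughs+2 (N div t)))) (≤-reflexive (distrib t (roughs (N div t)))))
  where
  distrib : ∀ t r → suc (3 * r + 2) * t ≡ 3 * t * r + 3 * t
  distrib = solve-∀

-- Convergence

-- This is 1 / (2ⁱ3ʲ) over the common denominator 6ᵏ, for i , j ≤ k.
weight : ℕ → ℕ → ℕ → ℕ
weight k i j = 2 ^ (k ∸ i) * 3 ^ (k ∸ j)

weight-s : ∀ {k i j} → i ≤ k → j ≤ k → weight k i j * smooth i j ≡ smooth k k
weight-s {k} {i} {j} i≤k j≤k = trans (s-+ (k ∸ i) (k ∸ j) i j) (cong₂ smooth (m∸n+n≡m i≤k) (m∸n+n≡m j≤k))

geometric2 : ∀ k → ∑ k (λ i → 2 ^ (k ∸ i)) + 2 ≡ 2 * 2 ^ k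
geometric2 zero    = refl
geometric2 (suc k) = trans (cong (_+ 2) (∑-front k _)) (trans (+-assoc (2 * 2 ^ k) _ 2)
  (trans (cong (2 * 2 ^ k +_) (geometric2 k)) (cong (2 * 2 ^ k +_) (sym (+-identityʳ _)))))

geometric3 : ∀ k → 2 * ∑ k (λ i → 3 ^ (k ∸ i)) + 3 ≡ 3 * 3 ^ k
geometric3 zero    = refl
geometric3 (suc k) = trans (cong (λ x → 2 * x + 3) (∑-front k _)) (trans (regroup (3 * 3 ^ k) (∑ k (λ i → 3 ^ (k ∸ i))))
  (trans (cong (2 * (3 * 3 ^ k) +_) (geometric3 k)) (triple (3 ^ k))))
  where
  regroup : ∀ x y → 2 * (x + y) + 3 ≡ 2 * x + (2 * y + 3)
  regroup = solve-∀
  triple : ∀ x → 2 * (3 * x) + 3 * x ≡ 3 * (3 * x)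
  triple = solve-∀

grid-product : ∀ k f h → grid k (λ i j → f i * h j) ≡ ∑ k f * ∑ k h
grid-product k f h = trans (∑-cong k (λ i _ → ∑-*ˡ k (f i) h)) (∑-*ʳ k f (∑ k h))

-- With p = 2ᵏ and q = 3ᵏ the weights sum to 3 (p - 1) (q - 1), and p ≤ q bounds the loss 3 p + 3 q
-- - 3 by 6 q.
weights-total : ∀ k → 3 * smooth k k ≤ grid k (weight k) + 6 * 3 ^ k
weights-total k = *-cancelˡ-≤ 2 (≤-trans (≤-reflexive (lhs (2 ^ k) (3 ^ k)))
  (≤-trans (≤-reflexive (cong₂ _*_ (sym (geometric2 k)) (sym (geometric3 k))))
  (≤-trans (≤-reflexive (expand a b))
  (≤-trans (+-monoʳ-≤ (2 * (a * b)) (≤-trans (≤-reflexive (extra a b)) (+-monoʳ-≤ (3 * (a + 2)) (m≤m+n (4 * b) 6))))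
  (≤-trans (+-monoʳ-≤ (2 * (a * b)) (≤-trans (≤-reflexive (cong (3 * (a + 2) +_) (double b))) (≤-reflexive (cong₂ (λ x y → 3 * x + 2 * y) (geometric2 k) (geometric3 k)))))
  (≤-trans (+-monoʳ-≤ (2 * (a * b)) (+-monoˡ-≤ (2 * (3 * 3 ^ k)) (*-monoʳ-≤ 3 (*-monoʳ-≤ 2 (2^≤3^ k)))))
  (≤-reflexive (trans (final (a * b) (3 ^ k)) (cong (λ x → 2 * (x + 6 * 3 ^ k)) (sym (grid-product k _ _)))))))))))
  where
  a b : ℕ
  a = ∑ k (λ i → 2 ^ (k ∸ i))
  b = ∑ k (λ i → 3 ^ (k ∸ i))
  lhs : ∀ p q → 2 * (3 * (p * q)) ≡ 2 * p * (3 * q)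
  lhs = solve-∀
  expand : ∀ a b → (a + 2) * (2 * b + 3) ≡ 2 * (a * b) + (3 * a + 4 * b + 6)
  expand = solve-∀
  extra : ∀ a b → 3 * a + 4 * b + 6 ≡ 3 * (a + 2) + 4 * b
  extra = solve-∀
  double : ∀ b → 4 * b + 6 ≡ 2 * (2 * b + 3)
  double = solve-∀
  final : ∀ x q → 2 * x + (3 * (2 * q) + 2 * (3 * q)) ≡ 2 * (x + 6 * q)
  final = solve-∀

-- The coefficients are general because they will be both `e` and `1 ∸ e`.
grid-ρ-lower : ∀ D N k (c : ℕ → ℕ → ℕ) → N ≤ D → k ≤ D →
  N * grid k (λ i j → c i j * weight k i j) ≤
  3 * smooth k k * grid D (λ i j → c i j * ρ D N (smooth i j)) + grid k (λ i j → c i j * (3 * smooth k k))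
grid-ρ-lower D N k c N≤D k≤D = ≤-trans (≤-reflexive (sym (grid-*ˡ k N _)))
  (≤-trans (grid-mono k cell)
  (≤-trans (≤-reflexive (grid-+ k _ _))
  (+-monoˡ-≤ _ (≤-trans (≤-reflexive (grid-*ˡ k (3 * smooth k k) _)) (*-monoʳ-≤ (3 * smooth k k) (grid-range _ k≤D))))))
  where
  cell : ∀ i j → i < k → j < k → N * (c i j * weight k i j) ≤ 3 * smooth k k * (c i j * ρ D N (smooth i j)) + c i j * (3 * smooth k k)
  cell i j i<k j<k = ≤-trans (≤-reflexive (*-comm N (c i j * weight k i j)))
    (≤-trans (*-monoʳ-≤ (c i j * weight k i j) (ρ-lower D N (smooth i j) {{>-nonZero (s≥1 i j)}} N≤D))
    (≤-reflexive (trans (regroup (c i j) (weight k i j) (smooth i j) (ρ D N (smooth i j)))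
      (cong (λ x → 3 * x * (c i j * ρ D N (smooth i j)) + c i j * (3 * x)) (weight-s (<⇒≤ i<k) (<⇒≤ j<k))))))
    where
    regroup : ∀ c w t r → c * w * (3 * t * r + 3 * t) ≡ 3 * (w * t) * (c * r) + c * (3 * (w * t))
    regroup = solve-∀

module Increments (g : ℕ → ℕ) (G : ∀ N → IsG3 N (g N)) where

  g-mono : ∀ n → g n ≤ g (suc n)
  g-mono n = let open Optimum (optimum (G n)) in
    ≤-trans (≤-reflexive (sym size)) (≤-trans (m≤m+n _ _) (maximal (G (suc n)) set free))

  g-suc : ∀ n → g (suc n) ≤ suc (g n)
  g-suc n = let open Optimum (optimum (G (suc n))) in
    ≤-trans (≤-reflexive (sym size)) (≤-trans (+-mono-≤ (maximal (G n) set free) (⟦⟧≤1 (set (suc n)))) (≤-reflexive (+-comm (g n) 1)))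

  g-zero : g 0 ≡ 0
  g-zero = sym (Optimum.size (optimum (G 0)))

  -- Take optimal sets for 2ⁱ3ʲb and 2ⁱ3ʲ - 1 (or for 2ⁱ3ʲb - 1 and 2ⁱ3ʲ) and exchange the class of b in the
  -- first with the class of 1 in the second.
  exchange : ∀ i₀ j₀ b {n m} → rough (suc b) ≡ true → smooth i₀ j₀ ≡ suc m → smooth i₀ j₀ * suc b ≡ suc n →
    g n + g (suc m) ≡ g (suc n) + g m
  exchange i₀ j₀ b {n} {m} r eqm eqn = ≤-antisym to from
    where
    swapped-Free : ∀ X Y → Free X → Free Y → Free (replace X (suc b) (class Y 1)) × Free (replace Y 1 (class X (suc b)))
    swapped-Free X Y fx fy =
      replace-Free {X} (suc b) fx (class-APFree {Y} (s≤s z≤n) fy) , replace-Free {Y} 1 fy (class-APFree {X} (s≤s z≤n) fx)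
    top : ∀ X Y → replace X (suc b) (class Y 1) (suc n) ≡ Y (suc m)
    top X Y = trans (cong (replace X (suc b) (class Y 1)) (sym eqn))
      (trans (replace-at X (class Y 1) r i₀ j₀) (cong Y (trans (*-identityʳ (smooth i₀ j₀)) eqm)))
    top₁ : ∀ X Y → replace Y 1 (class X (suc b)) (suc m) ≡ X (suc n)
    top₁ X Y = trans (cong (replace Y 1 (class X (suc b))) (trans (sym eqm) (sym (*-identityʳ (smooth i₀ j₀)))))
      (trans (replace-at Y (class X (suc b)) refl i₀ j₀) (cong X eqn))
    to : g n + g (suc m) ≤ g (suc n) + g m
    to = let open Optimum (optimum (G n)) renaming (set to X; free to fx; size to sx)
             open Optimum (optimum (G (suc m))) renaming (set to Y; free to fy; size to sy)
             fx′ , fy′ = swapped-Free X Y fx fy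
         in ≤-trans (≤-reflexive (trans (cong₂ _+_ (sym sx) (sym sy)) (trans (sym (+-assoc (cnt X n) (cnt Y m) _))
              (trans (cong₂ (λ u v → u + ⟦ v ⟧) (sym (cnt-swap X Y b {i₀ = i₀} {j₀} r eqm eqn)) (sym (top X Y)))
                (+-swapʳ (cnt (replace X (suc b) (class Y 1)) n) (cnt (replace Y 1 (class X (suc b))) m) _)))))
            (+-mono-≤ (maximal (G (suc n)) (replace X (suc b) (class Y 1)) fx′) (maximal (G m) (replace Y 1 (class X (suc b))) fy′))
    from : g (suc n) + g m ≤ g n + g (suc m)
    from = let open Optimum (optimum (G (suc n))) renaming (set to X; free to fx; size to sx)
               open Optimum (optimum (G m)) renaming (set to Y; free to fy; size to sy)
               fx′ , fy′ = swapped-Free X Y fx fy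
           in ≤-trans (≤-reflexive (trans (cong₂ _+_ (sym sx) (sym sy)) (trans (+-swapʳ (cnt X n) _ (cnt Y m))
                (trans (cong₂ (λ u v → u + ⟦ v ⟧) (sym (cnt-swap X Y b {i₀ = i₀} {j₀} r eqm eqn)) (sym (top₁ X Y)))
                  (+-assoc (cnt (replace X (suc b) (class Y 1)) n) _ _)))))
              (+-mono-≤ (maximal (G n) (replace X (suc b) (class Y 1)) fx′) (maximal (G (suc m)) (replace Y 1 (class X (suc b))) fy′))

  e : ℕ → ℕ
  e n = g n ∸ g (pred n)

  e≤1 : ∀ n → e n ≤ 1
  e≤1 zero    = ≤-trans (≤-reflexive (n∸n≡0 (g 0))) z≤n
  e≤1 (suc n) = ≤-trans (∸-monoˡ-≤ (g n) (g-suc n)) (≤-reflexive (m+n∸n≡m 1 (g n)))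

  e-suc : ∀ n → g n + e (suc n) ≡ g (suc n)
  e-suc n = m+[n∸m]≡n (g-mono n)

  g-∑e : ∀ N → g N ≡ ∑ N (λ k → e (suc k))
  g-∑e zero    = g-zero
  g-∑e (suc N) = trans (sym (e-suc N)) (cong (_+ e (suc N)) (g-∑e N))

  -- `exchange` equates the increments of `g` at 2ⁱ3ʲb and at 2ⁱ3ʲ; the subtractions in `e` are
  -- exact because `g` is monotone.
  e-class : ∀ i j b → rough b ≡ true → e (smooth i j * b) ≡ e (smooth i j)
  e-class i j zero    ()
  e-class i j (suc b) r with smooth i j in eqm | s≥1 i j
  ... | suc m | _ = +-cancelʳ-≡ (g n + g m) _ _
    (trans (sym (+-assoc (e (suc n)) (g n) (g m))) (trans (cong (_+ g m) (trans (+-comm (e (suc n)) (g n)) (e-suc n)))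
    (trans (sym (exchange i j b {n} {m} r eqm (cong (_* suc b) eqm)))
    (trans (cong (g n +_) (trans (sym (e-suc m)) (+-comm (g m) _))) (regroup (g n) (e (suc m)) (g m))))))
    where
    n : ℕ
    -- For this `n` the product `suc m * suc b` reduces to `suc n`.
    n = b + m * suc b
    regroup : ∀ x y z → x + (y + z) ≡ y + (x + z)
    regroup = solve-∀

  g-grid : ∀ D N → N ≤ D → g N ≡ grid D (λ i j → e (smooth i j) * ρ D N (smooth i j))
  g-grid D N N≤D = trans (g-∑e N) (trans (decompose D N e N≤D)
    (grid-cong D (λ i j _ _ → trans (∑-cong D (λ b _ → cell i j b)) (∑-*ˡ D (e (smooth i j)) _))))
    where
    cell : ∀ i j b → ⟦ rough (suc b) ⟧ * (⟦ smooth i j * suc b ≤ᵇ N ⟧ * e (smooth i j * suc b)) ≡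
      e (smooth i j) * (⟦ rough (suc b) ⟧ * ⟦ smooth i j * suc b ≤ᵇ N ⟧)
    cell i j b with rough (suc b) in r
    ... | false = sym (*-zeroʳ (e (smooth i j)))
    ... | true  = trans (cong (λ x → 1 * (⟦ smooth i j * suc b ≤ᵇ N ⟧ * x)) (e-class i j (suc b) r))
                    (trans (*-identityˡ _) (trans (*-comm _ (e (smooth i j))) (cong (e (smooth i j) *_) (sym (*-identityˡ _)))))

  N-grid : ∀ D N → N ≤ D → N ≡ grid D (λ i j → ρ D N (smooth i j))
  N-grid D N N≤D = trans (trans (sym (*-identityʳ N)) (sym (∑-const N)))
    (trans (decompose D N (λ _ → 1) N≤D)
    (grid-cong D (λ i j _ _ → ∑-cong D (λ b _ → cong (⟦ rough (suc b) ⟧ *_) (*-identityʳ _)))))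
    where
    ∑-const : ∀ N → ∑ N (λ _ → 1) ≡ N * 1
    ∑-const zero    = refl
    ∑-const (suc N) = trans (cong (_+ 1) (∑-const N)) (+-comm (N * 1) 1)

  -- `N` and `g N` are expanded over the same grid, so an upper estimate of `g N` follows from a
  -- lower estimate of the remaining sum.
  complement : ∀ D N → N ≤ D → N ≡ g N + grid D (λ i j → (1 ∸ e (smooth i j)) * ρ D N (smooth i j))
  complement D N N≤D = trans (N-grid D N N≤D) (trans
    (grid-cong D (λ i j _ _ → trans (sym (*-identityˡ _)) (trans (cong (_* ρ D N (smooth i j)) (sym (m+[n∸m]≡n (e≤1 (smooth i j)))))
      (*-distribʳ-+ (ρ D N (smooth i j)) (e (smooth i j)) (1 ∸ e (smooth i j))))))
    (trans (grid-+ D _ _) (cong (_+ grid D (λ i j → (1 ∸ e (smooth i j)) * ρ D N (smooth i j))) (sym (g-grid D N N≤D)))))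

  -- `H` is the sum over i , j < k with denominator 3 · 6ᵏ. The bounds confine `g N / N` to an
  -- interval of length 6 · 3ᵏ / (3 · 6ᵏ) = 2 / 2ᵏ, up to terms of order 1 / N.
  approximate : ∀ k → ∃[ H ] ∃[ E ] (∀ N → N * H ≤ 3 * smooth k k * g N + E × 3 * smooth k k * g N ≤ N * (H + 6 * 3 ^ k) + E)
  approximate k = H , E₁ + E₂ , λ N →
    ≤-trans (lower N) (+-monoʳ-≤ (Q * g N) (m≤m+n E₁ E₂)) ,
    +-cancelʳ-≤ (Q * R N) (Q * g N) (N * (H + 6 * 3 ^ k) + (E₁ + E₂))
      (≤-trans (≤-reflexive (trans (sym (*-distribˡ-+ Q (g N) (R N))) (trans (cong (Q *_) (sym (complement (N + k) N (m≤m+n N k)))) (*-comm Q N))))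
      (≤-trans (*-monoʳ-≤ N (≤-trans (weights-total k) (≤-reflexive (cong (_+ 6 * 3 ^ k) total))))
      (≤-trans (≤-reflexive (expand N H H′ (6 * 3 ^ k)))
      (≤-trans (+-monoʳ-≤ (N * (H + 6 * 3 ^ k)) (≤-trans (lower′ N) (+-monoʳ-≤ (Q * R N) (m≤n+m E₂ E₁))))
      (≤-reflexive (rearrange (N * (H + 6 * 3 ^ k)) (Q * R N) (E₁ + E₂)))))))
    where
    Q H H′ E₁ E₂ : ℕ
    Q = 3 * smooth k k
    H = grid k (λ i j → e (smooth i j) * weight k i j)
    H′ = grid k (λ i j → (1 ∸ e (smooth i j)) * weight k i j)
    E₁ = grid k (λ i j → e (smooth i j) * Q)
    E₂ = grid k (λ i j → (1 ∸ e (smooth i j)) * Q)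
    R : ℕ → ℕ
    R N = grid (N + k) (λ i j → (1 ∸ e (smooth i j)) * ρ (N + k) N (smooth i j))
    lower : ∀ N → N * H ≤ Q * g N + E₁
    lower N = subst (λ x → N * H ≤ Q * x + E₁) (sym (g-grid (N + k) N (m≤m+n N k)))
      (grid-ρ-lower (N + k) N k (λ i j → e (smooth i j)) (m≤m+n N k) (m≤n+m k N))
    lower′ : ∀ N → N * H′ ≤ Q * R N + E₂
    lower′ N = grid-ρ-lower (N + k) N k (λ i j → 1 ∸ e (smooth i j)) (m≤m+n N k) (m≤n+m k N)
    total : grid k (weight k) ≡ H + H′
    total = trans (grid-cong k (λ i j _ _ → trans (sym (*-identityˡ _)) (trans (cong (_* weight k i j) (sym (m+[n∸m]≡n (e≤1 (smooth i j)))))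
      (*-distribʳ-+ (weight k i j) (e (smooth i j)) (1 ∸ e (smooth i j)))))) (grid-+ k _ _)
    expand : ∀ N h h′ d → N * (h + h′ + d) ≡ N * (h + d) + N * h′
    expand = solve-∀
    rearrange : ∀ x y z → x + (y + z) ≡ x + z + y
    rearrange = solve-∀

-- From integer inequalities to rationals

frac : ℕ → ℕ → ℚ.ℚ
frac a n = ℤ.+ a ℚ./ suc n

-- Comparisons pass through unnormalised fractions, where `<` is cross multiplication of the given
-- numerators and denominators; `frac` itself is in lowest terms.
toℚᵘ-frac : ∀ a n → ℚ.toℚᵘ (frac a n) ℚᵘ.≃ ℚᵘ.mkℚᵘ (ℤ.+ a) n
toℚᵘ-frac a n = ℚ.toℚᵘ-fromℚᵘ (ℚᵘ.mkℚᵘ (ℤ.+ a) n)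

<-frac : ∀ x {a n} → ℚ.toℚᵘ x ℚᵘ.< ℚᵘ.mkℚᵘ (ℤ.+ a) n → x ℚ.< frac a n
<-frac x {a} {n} lt = ℚ.toℚᵘ-cancel-< (ℚᵘ.<-respʳ-≃ (ℚᵘ.≃-sym (toℚᵘ-frac a n)) lt)

frac-< : ∀ x {a n} → ℚᵘ.mkℚᵘ (ℤ.+ a) n ℚᵘ.< ℚ.toℚᵘ x → frac a n ℚ.< x
frac-< x {a} {n} lt = ℚ.toℚᵘ-cancel-< (ℚᵘ.<-respˡ-≃ (ℚᵘ.≃-sym (toℚᵘ-frac a n)) lt)

frac-<-+ : ∀ {a m b n p d-1} .(c : Coprime p (suc d-1)) → a * (suc n * suc d-1) < (b * suc d-1 + p * suc n) * suc m →
  frac a m ℚ.< frac b n ℚ.+ ℚ.mkℚ (ℤ.+ p) d-1 c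
frac-<-+ {a} {m} {b} {n} {p} {d-1} c lt = frac-< (frac b n ℚ.+ ℚ.mkℚ (ℤ.+ p) d-1 c) {a} {m}
  (ℚᵘ.<-respʳ-≃ (ℚᵘ.≃-sym (ℚᵘ.≃-trans (ℚ.toℚᵘ-homo-+ (frac b n) (ℚ.mkℚ (ℤ.+ p) d-1 c)) (ℚᵘ.+-congˡ (ℚᵘ.mkℚᵘ (ℤ.+ p) d-1) (toℚᵘ-frac b n))))
    (ℚᵘ.*<* (subst₂ ℤ._<_ (ℤ.pos-* a (suc n * suc d-1)) (trans (ℤ.pos-* (b * suc d-1 + p * suc n) (suc m))
      (cong (ℤ._* ℤ.+ suc m) (cong₂ ℤ._+_ (ℤ.pos-* b (suc d-1)) (ℤ.pos-* p (suc n))))) (ℤ.+<+ lt))))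

-‿<⇒ : ∀ x y z → x ℚ.< y ℚ.+ z → x ℚ.- y ℚ.< z
-‿<⇒ x y z lt = subst (x ℚ.- y ℚ.<_)
  (trans (cong (ℚ._- y) (ℚ.+-comm y z)) (trans (ℚ.+-assoc z y (ℚ.- y)) (trans (cong (z ℚ.+_) (ℚ.+-inverseʳ y)) (ℚ.+-identityʳ z))))
  (ℚ.+-monoˡ-< (ℚ.- y) lt)

neg-- : ∀ x y → ℚ.- (x ℚ.- y) ≡ y ℚ.- x
neg-- x y = trans (ℚ.neg-distrib-+ x (ℚ.- y)) (trans (cong (ℚ.- x ℚ.+_) (⁻¹-involutive y)) (ℚ.+-comm (ℚ.- x) y))

∣-∣-< : ∀ x y z → x ℚ.< y ℚ.+ z → y ℚ.< x ℚ.+ z → ℚ.∣ x ℚ.- y ∣ ℚ.< z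
∣-∣-< x y z lt lt′ with ℚ.∣p∣≡p∨∣p∣≡-p (x ℚ.- y)
... | inj₁ eq = subst (ℚ._< z) (sym eq) (-‿<⇒ x y z lt)
... | inj₂ eq = subst (ℚ._< z) (sym (trans eq (neg-- x y))) (-‿<⇒ y x z lt′)

Approximable : (ℕ → ℕ) → Set
Approximable g = ∀ k → ∃[ H ] ∃[ E ] (∀ N → N * H ≤ 3 * smooth k k * g N + E × 3 * smooth k k * g N ≤ N * (H + 6 * 3 ^ k) + E)

-- Here x = g M, y = g N, and the conclusion is x / M < y / N + 1 / d. After scaling by 4 Q the
-- truncation costs at most Q M N and each constant `E` at most M N; together (Q + 2) M N < 4 Q M N.
cross-core : ∀ d Q t H E x y M N → N * H ≤ Q * y + E → Q * x ≤ M * (H + 6 * t) + E → 3 * (8 * d * t) ≤ Q →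
  1 ≤ Q → 4 * d * E ≤ M → 4 * d * E ≤ N → 1 ≤ M * N → d * (x * N) < d * (y * M) + M * N
cross-core d Q t H E x y M N lower upper small 1≤Q M-large N-large 1≤MN =
  *-cancelˡ-< (4 * Q) (d * (x * N)) (d * (y * M) + M * N) (begin-strict
    4 * Q * (d * (x * N))                                                    ≡⟨ e₁ Q d x N ⟩
    4 * d * (N * (Q * x))                                                    ≤⟨ *-monoʳ-≤ (4 * d) (*-monoʳ-≤ N upper) ⟩
    4 * d * (N * (M * (H + 6 * t) + E))                                      ≡⟨ e₂ d N M H t E ⟩
    4 * d * (M * (N * H)) + 3 * (8 * d * t) * (M * N) + N * (4 * d * E)
      ≤⟨ +-mono-≤ (+-mono-≤ (*-monoʳ-≤ (4 * d) (*-monoʳ-≤ M lower)) (*-monoˡ-≤ (M * N) small)) (*-monoʳ-≤ N M-large) ⟩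
    4 * d * (M * (Q * y + E)) + Q * (M * N) + N * M                          ≡⟨ e₃ d M Q y E N ⟩
    4 * Q * (d * (y * M)) + Q * (M * N) + (M * (4 * d * E) + N * M)
      ≤⟨ +-monoʳ-≤ (4 * Q * (d * (y * M)) + Q * (M * N)) (+-monoˡ-≤ (N * M) (*-monoʳ-≤ M N-large)) ⟩
    4 * Q * (d * (y * M)) + Q * (M * N) + (M * N + N * M)                    ≡⟨ e₄ (4 * Q * (d * (y * M))) Q M N ⟩
    4 * Q * (d * (y * M)) + (Q + 2) * (M * N)
      <⟨ +-monoʳ-< (4 * Q * (d * (y * M))) (*-monoˡ-< (M * N) {{>-nonZero 1≤MN}} (+-monoʳ-< Q (≤-trans (n<1+n 2) (*-monoʳ-≤ 3 1≤Q)))) ⟩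
    4 * Q * (d * (y * M)) + 4 * Q * (M * N)                                  ≡⟨ sym (*-distribˡ-+ (4 * Q) (d * (y * M)) (M * N)) ⟩
    4 * Q * (d * (y * M) + M * N) ∎)
  where
  open ≤-Reasoning
  e₁ : ∀ Q d x N → 4 * Q * (d * (x * N)) ≡ 4 * d * (N * (Q * x))
  e₁ = solve-∀
  e₂ : ∀ d N M H t E → 4 * d * (N * (M * (H + 6 * t) + E)) ≡ 4 * d * (M * (N * H)) + 3 * (8 * d * t) * (M * N) + N * (4 * d * E)
  e₂ = solve-∀
  e₃ : ∀ d M Q x E N → 4 * d * (M * (Q * x + E)) + Q * (M * N) + N * M ≡ 4 * Q * (d * (x * M)) + Q * (M * N) + (M * (4 * d * E) + N * M)
  e₃ = solve-∀
  e₄ : ∀ X Q M N → X + Q * (M * N) + (M * N + N * M) ≡ X + (Q + 2) * (M * N)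
  e₄ = solve-∀

module _ {g : ℕ → ℕ} (approximate : Approximable g) where

  cross : ∀ d → ∃[ n₀ ] (∀ M N → n₀ ≤ M → n₀ ≤ N → 1 ≤ M → 1 ≤ N → d * (g M * N) < d * (g N * M) + M * N)
  -- k = 8 d is deep enough because 8 d < 2^(8 d), which gives 3 (8 d 3ᵏ) ≤ 3 · 6ᵏ.
  cross d with approximate (8 * d)
  ... | H , E , bounds = 4 * d * E , λ M N n₀≤M n₀≤N 1≤M 1≤N →
    cross-core d (3 * smooth (8 * d) (8 * d)) (3 ^ (8 * d)) H E (g M) (g N) M N (proj₁ (bounds N)) (proj₂ (bounds M))
      (*-monoʳ-≤ 3 (*-monoˡ-≤ (3 ^ (8 * d)) (<⇒≤ (i<2^i (8 * d)))))
      (*-mono-≤ {1} {3} (s≤s z≤n) (s≥1 (8 * d) (8 * d))) n₀≤M n₀≤N (*-mono-≤ 1≤M 1≤N)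

  cauchy : Cauchy (ratio g)
  cauchy (ℚ.mkℚ (ℤ.+ zero) d-1 _) (ℚ.*<* (ℤ.+<+ ()))
  cauchy (ℚ.mkℚ ℤ.-[1+ p ] d-1 _) (ℚ.*<* ())
  -- The numerator is at least 1, so `ε` is at least the reciprocal of its denominator, and `cross`
  -- at that denominator suffices.
  cauchy ε@(ℚ.mkℚ (ℤ.+ suc p) d-1 c) _ = proj₁ (cross (suc d-1)) , λ m n n₀≤m n₀≤n →
    ∣-∣-< (ratio g m) (ratio g n) ε (below m n n₀≤m n₀≤n) (below n m n₀≤n n₀≤m)
    where
    below : ∀ m n → proj₁ (cross (suc d-1)) ≤ m → proj₁ (cross (suc d-1)) ≤ n → ratio g m ℚ.< ratio g n ℚ.+ ε
    below m n n₀≤m n₀≤n = frac-<-+ {g (suc m)} {m} {g (suc n)} {n} {suc p} {d-1} c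
      (≤-<-trans (≤-reflexive (e₁ (g (suc m)) (suc n) (suc d-1)))
        (<-≤-trans (proj₂ (cross (suc d-1)) (suc m) (suc n) (m≤n⇒m≤1+n n₀≤m) (m≤n⇒m≤1+n n₀≤n) (s≤s z≤n) (s≤s z≤n))
          (≤-trans (+-monoʳ-≤ (suc d-1 * (g (suc n) * suc m)) (m≤n*m (suc m * suc n) (suc p)))
            (≤-reflexive (e₂ (suc d-1) (g (suc n)) (suc m) (suc p) (suc n))))))
      where
      e₁ : ∀ x n d → x * (n * d) ≡ d * (x * n)
      e₁ = solve-∀
      e₂ : ∀ d x m p n → d * (x * m) + p * (m * n) ≡ (x * d + p * n) * m
      e₂ = solve-∀

-- Searching for AP-free sets

-- The value at 1024 of the polynomial with these exponents. A product of two such values adds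
-- exponents pairwise (`powers-sums`), so its digits record all sums of two elements.
powers : List ℕ → ℕ
powers []       = 0
powers (e ∷ es) = 1024 ^ e + powers es

sums : List ℕ → List ℕ → List ℕ
sums []       ys = []
sums (x ∷ xs) ys = map (x +_) ys ++ sums xs ys

powers-++ : ∀ xs ys → powers (xs ++ ys) ≡ powers xs + powers ys
powers-++ []       ys = refl
powers-++ (x ∷ xs) ys = trans (cong (1024 ^ x +_) (powers-++ xs ys)) (sym (+-assoc (1024 ^ x) _ _))

powers-shift : ∀ x ys → powers (map (x +_) ys) ≡ 1024 ^ x * powers ys
powers-shift x []       = sym (*-zeroʳ (1024 ^ x))
powers-shift x (y ∷ ys) = trans (cong₂ _+_ (^-distribˡ-+-* 1024 x y) (powers-shift x ys)) (sym (*-distribˡ-+ (1024 ^ x) _ _))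

powers-sums : ∀ xs ys → powers xs * powers ys ≡ powers (sums xs ys)
powers-sums []       ys = refl
powers-sums (x ∷ xs) ys = trans (*-distribʳ-+ (powers ys) (1024 ^ x) (powers xs))
  (trans (cong₂ _+_ (sym (powers-shift x ys)) (powers-sums xs ys)) (sym (powers-++ (map (x +_) ys) (sums xs ys))))

length-sums : ∀ xs ys → length (sums xs ys) ≡ length xs * length ys
length-sums []       ys = refl
length-sums (x ∷ xs) ys = trans (length-++ (map (x +_) ys)) (cong₂ _+_ (length-map (x +_) ys) (length-sums xs ys))

All-sums : ∀ {P : ℕ → Set} {xs ys} → All (λ x → All (λ y → P (x + y)) ys) xs → All P (sums xs ys)
All-sums []       = []
All-sums (a ∷ as) = ++⁺ (map⁺ a) (All-sums as)

-- An exponent below `p` contributes at most 1024ᵖ / 1024. Fewer than 1024 of them leave `lo` below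
-- 1024ᵖ, so nothing is carried into the digit at `p`.
powers-split : ∀ p es → All (_≢ p) es →
  ∃[ lo ] ∃[ q ] (powers es ≡ lo + q * 1024 * 1024 ^ p × lo * 1024 ≤ length es * 1024 ^ p)
powers-split p []       []        = 0 , 0 , refl , z≤n
powers-split p (e ∷ es) (e≢p ∷ a) with powers-split p es a | <-cmp e p
... | lo , q , eq , le | tri≈ _ e≡p _ = ⊥-elim (e≢p e≡p)
... | lo , q , eq , le | tri< e<p _ _ = 1024 ^ e + lo , q , trans (cong (1024 ^ e +_) eq) (sym (+-assoc (1024 ^ e) lo _)) ,
      ≤-trans (≤-reflexive (*-distribʳ-+ 1024 (1024 ^ e) lo))
        (+-mono-≤ (≤-trans (≤-reflexive (*-comm (1024 ^ e) 1024)) (^-monoʳ-≤ 1024 e<p)) le)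
... | lo , q , eq , le | tri> _ _ p<e = lo , 1024 ^ (e ∸ suc p) + q ,
      trans (cong₂ _+_ (trans (cong (1024 ^_) (sym (m∸n+n≡m p<e))) (trans (^-distribˡ-+-* 1024 (e ∸ suc p) (suc p)) (sym (*-assoc (1024 ^ (e ∸ suc p)) 1024 (1024 ^ p))))) eq)
        (regroup (1024 ^ (e ∸ suc p)) q lo (1024 ^ p)) ,
      ≤-trans le (*-monoˡ-≤ (1024 ^ p) (n≤1+n (length es)))
  where
  regroup : ∀ x q l b → x * 1024 * b + (l + q * 1024 * b) ≡ l + (x + q) * 1024 * b
  regroup x q l b = trans (sym (+-assoc (x * 1024 * b) l _)) (trans (cong (_+ q * 1024 * b) (+-comm (x * 1024 * b) l))
    (trans (+-assoc l _ _) (cong (l +_) (trans (sym (*-distribʳ-+ b (x * 1024) (q * 1024))) (cong (_* b) (sym (*-distribʳ-+ 1024 x q)))))))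

-- This direction makes pruning sound: a nonzero digit certifies that `p` is one of the listed
-- exponents.
digit-zero : ∀ {p k es} → suc k ≡ 1024 ^ p → length es < 1024 → All (_≢ p) es → powers es div suc k % 1024 ≡ 0
digit-zero {p} {k} {es} eq len a with powers-split p es a
... | lo , q , split , le rewrite sym eq | split =
  trans (cong (_% 1024) (trans (+-distrib-/-∣ʳ lo {q * 1024 * suc k} {suc k} (n∣m*n (q * 1024)))
    (cong₂ _+_ (m<n⇒m/n≡0 lo<) (m*n/n≡m (q * 1024) (suc k))))) (m*n%n≡0 q 1024)
  where
  lo< : lo < suc k
  lo< = *-cancelˡ-< 1024 lo (suc k) (≤-<-trans (≤-trans (≤-reflexive (*-comm 1024 lo)) le) (*-monoˡ-< (suc k) len))

Pt : Set
Pt = ℕ × ℕ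

val : Pt → ℕ
val (i , j) = smooth i j

-- The powers of 1024 are computed once per point. `k₁` and `k₂` are one less than the divisors
-- because `div-helper` takes the predecessor of its divisor.
data Table : Set where
  nil  : Table
  cons : (h k₁ k₂ x d r : ℕ) → Table → Table

-- Depth-first search for n further points of an AP-free set, true if there are none; an entry h bounds
-- what the rest of the table can contribute. With points coded as numbers c and B = 1024, the set chosen
-- so far is kept as X = Σ Bᶜ, D = Σ B²ᶜ and R = Σ Bᴹ⁻ᶜ, so that a point c completes a progression iff
-- F₁ = D R has a nonzero digit at M + c (c an end point) or F₂ = X² has one at 2 c (c the midpoint).
go  : Table → ℕ → ℕ → ℕ → ℕ → ℕ → ℕ → Bool
goA : Bool → Table → ℕ → ℕ → ℕ → ℕ → ℕ → ℕ → Bool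
go₁ : ℕ → Table → ℕ → ℕ → ℕ → ℕ → ℕ → ℕ → Bool
go₂ : ℕ → Table → ℕ → ℕ → ℕ → ℕ → ℕ → ℕ → Bool

go nil                      n X D R F₁ F₂ = 0 <ᵇ n
go t@(cons h _ _ _ _ _ _)   n X D R F₁ F₂ = goA (h <ᵇ n) t n X D R F₁ F₂

goA true  _                         n X D R F₁ F₂ = true
goA false nil                       n X D R F₁ F₂ = false
goA false t@(cons _ k₁ _ _ _ _ _)   n X D R F₁ F₂ = go₁ (mod-helper 0 1023 (div-helper 0 k₁ F₁ k₁) 1023) t n X D R F₁ F₂

go₁ _       nil                        n X D R F₁ F₂ = false
go₁ (suc _) (cons _ _ _ _ _ _ t)       n X D R F₁ F₂ = go t n X D R F₁ F₂
go₁ zero    t@(cons _ _ k₂ _ _ _ _)    n X D R F₁ F₂ = go₂ (mod-helper 0 1023 (div-helper 0 k₂ F₂ k₂) 1023) t n X D R F₁ F₂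

go₂ _       nil                    n       X D R F₁ F₂ = false
go₂ (suc _) (cons _ _ _ _ _ _ t)   n       X D R F₁ F₂ = go t n X D R F₁ F₂
go₂ zero    (cons _ _ _ _ _ _ t)   zero    X D R F₁ F₂ = false
go₂ zero    (cons _ _ _ x d r t)   (suc n) X D R F₁ F₂ =
  go t n (x + X) (d + D) (r + R) ((d + D) * (r + R)) ((x + X) * (x + X)) ∧ go t (suc n) X D R F₁ F₂

-- Whatever the digit tests say, a successful search has also succeeded on the tail without the head
-- point.
go₁-skip : ∀ a h k₁ k₂ x d r t n X D R F₁ F₂ → go₁ a (cons h k₁ k₂ x d r t) n X D R F₁ F₂ ≡ true → go t n X D R F₁ F₂ ≡ true
go₁-skip (suc _) _ _ _ _ _ _ _ _ _ _ _ _ _ ok = ok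
go₁-skip zero h k₁ k₂ x d r t n X D R F₁ F₂ = skip (F₂ div suc k₂ % 1024) n
  where
  skip : ∀ b n → go₂ b (cons h k₁ k₂ x d r t) n X D R F₁ F₂ ≡ true → go t n X D R F₁ F₂ ≡ true
  skip (suc _) n       ok = ok
  skip zero    (suc n) ok = proj₂ (∧-true ok)

go₁-take : ∀ h k₁ k₂ x d r t n X D R F₁ F₂ → F₁ div suc k₁ % 1024 ≡ 0 → F₂ div suc k₂ % 1024 ≡ 0 →
  go₁ (F₁ div suc k₁ % 1024) (cons h k₁ k₂ x d r t) n X D R F₁ F₂ ≡ true →
  ∃[ n′ ] (n ≡ suc n′ × go t n′ (x + X) (d + D) (r + R) ((d + D) * (r + R)) ((x + X) * (x + X)) ≡ true)
go₁-take h k₁ k₂ x d r t n X D R F₁ F₂ e₁ e₂ ok = take n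
  (subst (λ b → go₂ b (cons h k₁ k₂ x d r t) n X D R F₁ F₂ ≡ true) e₂
    (subst (λ a → go₁ a (cons h k₁ k₂ x d r t) n X D R F₁ F₂ ≡ true) e₁ ok))
  where
  take : ∀ n → go₂ 0 (cons h k₁ k₂ x d r t) n X D R F₁ F₂ ≡ true →
    ∃[ n′ ] (n ≡ suc n′ × go t n′ (x + X) (d + D) (r + R) ((d + D) * (r + R)) ((x + X) * (x + X)) ≡ true)
  take (suc n) ok = n , refl , proj₁ (∧-true ok)

data Kind : Set where
  hit search row col : Kind

-- Points come in decreasing order of 2ⁱ3ʲ. Each tail is claimed to have no AP-free subset with more
-- points than it has hits, for the reason given by the kind of its head: search, or removing the
-- bottom row (row) or the left column (col).
Cert : Set
Cert = List (Kind × Pt)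

bound : Cert → ℕ
bound []              = 0
bound ((hit , _) ∷ L) = suc (bound L)
bound ((_   , _) ∷ L) = bound L

count : (ℕ → ℕ → Bool) → List Pt → ℕ
count C []             = 0
count C ((i , j) ∷ ps) = ⟦ C i j ⟧ + count C ps

points : Cert → List Pt
points = map proj₂

Valid : Cert → Set
Valid L = ∀ C → APFree C → count C (points L) ≤ bound L

AllValid : Cert → Set
AllValid []      = ⊤
AllValid (x ∷ L) = Valid (x ∷ L) × AllValid L

decreasing : List Pt → Bool
decreasing []           = true
decreasing (p ∷ [])     = true
decreasing (p ∷ q ∷ ps) = (val q <ᵇ val p) ∧ decreasing (q ∷ ps)

decreasing-tail : ∀ p ps → decreasing (p ∷ ps) ≡ true → decreasing ps ≡ true
decreasing-tail p []       _ = refl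
decreasing-tail p (q ∷ ps) d = proj₂ (∧-true {val q <ᵇ val p} d)

decreasing-below : ∀ p ps → decreasing (p ∷ ps) ≡ true → All (λ q → val q < val p) ps
decreasing-below p []       _ = []
decreasing-below p (q ∷ ps) d with ∧-true {val q <ᵇ val p} d
... | lt , d′ = q<p ∷ All.map (λ r<q → <-trans r<q q<p) (decreasing-below q ps d′)
  where q<p : val q < val p
        q<p = <ᵇ⇒< (val q) (val p) (true⇒T lt)

module Search (W M : ℕ) .{{_ : NonZero W}} where

  -- Base W with first digit `i`. On good points 2 i < W, so coordinates of a sum of two points can
  -- be read off the sum of their codes; and codes are at most M, so `M ∸ code q` is exact.
  code : Pt → ℕ
  code (i , j) = i + W * j

  good : Pt → Bool
  good (i , j) = (i + i <ᵇ W) ∧ (i + W * j ≤ᵇ M)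

  Good : Pt → Set
  Good p = good p ≡ true

  table : Cert → Table
  table []            = nil
  table ((k , p) ∷ L) = cons (bound ((k , p) ∷ L)) (pred (1024 ^ (M + code p))) (pred (1024 ^ (2 * code p)))
    (1024 ^ code p) (1024 ^ (2 * code p)) (1024 ^ (M ∸ code p)) (table L)

  ends mids : List Pt → List ℕ
  ends ch = sums (map (λ q → 2 * code q) ch) (map (λ q → M ∸ code q) ch)
  mids ch = sums (map code ch) (map code ch)

  X D R : List Pt → ℕ
  X ch = powers (map code ch)
  D ch = powers (map (λ q → 2 * code q) ch)
  R ch = powers (map (λ q → M ∸ code q) ch)

  run : Cert → ℕ → List Pt → Bool
  run L n ch = go (table L) n (X ch) (D ch) (R ch) (D ch * R ch) (X ch * X ch)

  code-unique : ∀ {a b c d} → a < W → c < W → a + W * b ≡ c + W * d → a ≡ c × b ≡ d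
  code-unique {a} {b} {c} {d} a<W c<W eq = a≡c , *-cancelˡ-≡ b d W (+-cancelˡ-≡ c _ _ (trans (cong (_+ W * b) (sym a≡c)) eq))
    where
    rem : ∀ {a b} → a < W → (a + W * b) % W ≡ a
    rem {a} {b} a<W = trans (cong (λ x → (a + x) % W) (*-comm W b)) (trans ([m+kn]%n≡m%n a b W) (m<n⇒m%n≡m a<W))
    a≡c : a ≡ c
    a≡c = trans (sym (rem {a} {b} a<W)) (trans (cong (_% W) eq) (rem {c} {d} c<W))

  average<W : ∀ {i i′} → i + i < W → i′ + i′ < W → i + i′ < W
  average<W {i} {i′} p p′ with ≤-total i i′
  ... | inj₁ le = ≤-<-trans (+-monoˡ-≤ i′ le) p′
  ... | inj₂ le = ≤-<-trans (+-monoʳ-≤ i le) p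

  decode : ∀ p q r → Good p → Good q → Good r → code p + code r ≡ code q + code q →
    proj₁ p + proj₁ r ≡ proj₁ q + proj₁ q × proj₂ p + proj₂ r ≡ proj₂ q + proj₂ q
  decode (i₁ , j₁) (i₂ , j₂) (i₃ , j₃) gp gq gr eq = code-unique {b = j₁ + j₃} {d = j₂ + j₂} (average<W {i₁} {i₃} (half {i₁} {j₁} gp) (half {i₃} {j₃} gr)) (half {i₂} {j₂} gq)
    (trans (gather i₁ j₁ i₃ j₃) (trans eq (sym (gather i₂ j₂ i₂ j₂))))
    where
    half : ∀ {i j} → Good (i , j) → i + i < W
    half {i} {j} g = <ᵇ⇒< (i + i) W (true⇒T (proj₁ (∧-true {i + i <ᵇ W} g)))
    gather : ∀ i j i′ j′ → i + i′ + W * (j + j′) ≡ (i + W * j) + (i′ + W * j′)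
    gather i j i′ j′ = trans (cong (i + i′ +_) (*-distribˡ-+ W j j′)) (interchange i i′ (W * j) (W * j′))

  Good⇒≤ : ∀ {p} → Good p → code p ≤ M
  Good⇒≤ {i , j} g = ≤ᵇ≡⇒≤ {i + W * j} (proj₂ (∧-true {i + i <ᵇ W} g))

  module _ {C : ℕ → ℕ → Bool} (free : APFree C) where

    record Chosen (q : Pt) : Set where
      constructor chosen
      field
        holds : C (proj₁ q) (proj₂ q) ≡ true
        is-good : Good q
    open Chosen

    AP-unique : ∀ {p q r : Pt} → Chosen p → Chosen q → Chosen r → code p + code r ≡ code q + code q → p ≡ r
    AP-unique {p} {q} {r} cp cq cr eq =
      let ei , ej = decode p q r (is-good cp) (is-good cq) (is-good cr) eq
          ei′ , ej′ = free _ _ _ _ _ _ (holds cp) (holds cq) (holds cr) ei ej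
      in cong₂ _,_ ei′ ej′

    module _ {p} (cp : Chosen p) {ch} (cs : All (λ q → Chosen q × val p < val q) ch) where

      -- A digit at M + c arises from 2 b + (M - c′) = M + c, that is c + c′ = 2 b. Freeness would
      -- then identify `p` with a chosen point, but all chosen points have larger value.
      no-end : All (_≢ M + code p) (ends ch)
      no-end = All-sums (map⁺ (All.map (λ {q} (cq , _) → map⁺ (All.map (λ {r} (cr , lt) eq →
        <-irrefl (cong val (AP-unique cp cq cr (collinear {code p} {code q} {code r} (Good⇒≤ {r} (is-good cr)) eq))) lt) cs)) cs))
        where
        collinear : ∀ {a b c} → c ≤ M → 2 * b + (M ∸ c) ≡ M + a → a + c ≡ b + b
        collinear {a} {b} {c} c≤M eq = +-cancelˡ-≡ M _ _ (trans (sym (+-assoc M a c)) (trans (cong (_+ c) (sym eq))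
          (trans (+-assoc (2 * b) (M ∸ c) c) (trans (cong₂ _+_ (cong (b +_) (+-identityʳ b)) (m∸n+n≡m c≤M)) (+-comm (b + b) M)))))

      -- Chosen points with midpoint `p` would coincide with each other, hence with `p`, whose value
      -- is smaller.
      no-mid : All (_≢ 2 * code p) (mids ch)
      no-mid = All-sums (map⁺ (All.map (λ {q} (cq , lt) → map⁺ (All.map (λ {r} (cr , _) eq →
        contra cq cr lt (trans eq (cong (code p +_) (+-identityʳ (code p))))) cs)) cs))
        where
        contra : ∀ {q r} → Chosen q → Chosen r → val p < val q → code q + code r ≡ code p + code p → ⊥
        contra {q} {r} cq cr lt eq with AP-unique cq cp cr eq
        ... | refl = <-irrefl (cong val (AP-unique cp cq cq (cong (_+ code q) (double-injective {code p} {code q} (sym eq))))) lt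

    -- `C` itself selects a path through the search tree: membership decides each branch, and
    -- `no-end` and `no-mid` show that this branch was not pruned. `length ch + n ≤ 31` persists
    -- along the path and keeps the number of pairs at most 961.
    run-sound : ∀ L n ch → AllValid L → decreasing (points L) ≡ true → All Good (points L) →
      All (λ q → Chosen q × All (λ p → val p < val q) (points L)) ch → length ch + n ≤ 31 →
      run L n ch ≡ true → count C (points L) < n
    run-sound [] n ch _ _ _ _ _ ok = <ᵇ⇒< 0 n (true⇒T ok)
    run-sound ((k , p) ∷ L) n ch (valid , valids) dec (gp ∷ gs) cs len ok with bound ((k , p) ∷ L) <ᵇ n in lt
    ... | true  = ≤-<-trans (valid C free) (<ᵇ⇒< _ n (true⇒T lt))
    ... | false with C (proj₁ p) (proj₂ p) in eqC
    ...   | false = run-sound L n ch valids (decreasing-tail p (points L) dec) gs (All.map (λ { (cq , _ ∷ lts) → cq , lts }) cs) len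
                      (go₁-skip ((D ch * R ch) div suc (pred (1024 ^ (M + code p))) % 1024) _ (pred (1024 ^ (M + code p))) (pred (1024 ^ (2 * code p)))
                        (1024 ^ code p) (1024 ^ (2 * code p)) (1024 ^ (M ∸ code p)) (table L) n (X ch) (D ch) (R ch) (D ch * R ch) (X ch * X ch) ok)
    ...   | true  = take (go₁-take _ (pred (1024 ^ (M + code p))) (pred (1024 ^ (2 * code p))) (1024 ^ code p) (1024 ^ (2 * code p)) (1024 ^ (M ∸ code p))
                      (table L) n (X ch) (D ch) (R ch) (D ch * R ch) (X ch * X ch) digit₁ digit₂ ok)
      where
      cp : Chosen p
      cp = chosen eqC gp
      cs′ : All (λ q → Chosen q × val p < val q) ch
      cs′ = All.map (λ { (cq , lt ∷ _) → cq , lt }) cs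
      pairs< : ∀ xs ys → length xs ≡ length ch → length ys ≡ length ch → length (sums xs ys) < 1024
      pairs< xs ys ex ey = ≤-<-trans
        (≤-trans (≤-reflexive (trans (length-sums xs ys) (cong₂ _*_ ex ey)))
          (*-mono-≤ {length ch} {31} (≤-trans (m≤m+n _ n) len) (≤-trans (m≤m+n _ n) len)))
        (toWitness {a? = 961 <? 1024} tt)
      digit₁ : (D ch * R ch) div suc (pred (1024 ^ (M + code p))) % 1024 ≡ 0
      digit₁ = trans (cong (λ F → F div suc (pred (1024 ^ (M + code p))) % 1024) (powers-sums (map (λ q → 2 * code q) ch) (map (λ q → M ∸ code q) ch)))
        (digit-zero {M + code p} {es = ends ch} (suc-pred (1024 ^ (M + code p)) {{m^n≢0 1024 (M + code p)}}) (pairs< (map (λ q → 2 * code q) ch) (map (λ q → M ∸ code q) ch) (length-map _ ch) (length-map _ ch)) (no-end cp cs′))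
      digit₂ : (X ch * X ch) div suc (pred (1024 ^ (2 * code p))) % 1024 ≡ 0
      digit₂ = trans (cong (λ F → F div suc (pred (1024 ^ (2 * code p))) % 1024) (powers-sums (map code ch) (map code ch)))
        (digit-zero {2 * code p} {es = mids ch} (suc-pred (1024 ^ (2 * code p)) {{m^n≢0 1024 (2 * code p)}}) (pairs< (map code ch) (map code ch) (length-map _ ch) (length-map _ ch)) (no-mid cp cs′))
      take : ∃[ n′ ] (n ≡ suc n′ × run L n′ (p ∷ ch) ≡ true) → 1 + count C (points L) < n
      take (n′ , refl , ok′) = s≤s (run-sound L n′ (p ∷ ch) valids (decreasing-tail p (points L) dec) gs
        ((cp , decreasing-below p (points L) dec) ∷ All.map (λ { (cq , _ ∷ lts) → cq , lts }) cs)
        (subst (_≤ 31) (+-suc (length ch) n′) len) ok′)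

-- Certificates

_=ᵖ_ : List Pt → List Pt → Bool
[]             =ᵖ []               = true
[]             =ᵖ (_ ∷ _)          = false
(_ ∷ _)        =ᵖ []               = false
((i , j) ∷ ps) =ᵖ ((i′ , j′) ∷ qs) = (i ≡ᵇ i′) ∧ (j ≡ᵇ j′) ∧ (ps =ᵖ qs)

=ᵖ-sound : ∀ ps qs → (ps =ᵖ qs) ≡ true → ps ≡ qs
=ᵖ-sound []             []               _  = refl
=ᵖ-sound ((i , j) ∷ ps) ((i′ , j′) ∷ qs) eq with ∧-true {i ≡ᵇ i′} eq
... | e₁ , eq′ with ∧-true {j ≡ᵇ j′} eq′
... | e₂ , e₃ = cong₂ _∷_ (cong₂ _,_ (≡ᵇ⇒≡ i i′ (true⇒T e₁)) (≡ᵇ⇒≡ j j′ (true⇒T e₂))) (=ᵖ-sound ps qs e₃)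

pull : (ℕ → ℕ → Bool) → (Pt → Pt) → ℕ → ℕ → Bool
pull C f i j = C (proj₁ (f (i , j))) (proj₂ (f (i , j)))

count-map : ∀ C f ps → count C (map f ps) ≡ count (pull C f) ps
count-map C f []             = refl
count-map C f ((i , j) ∷ ps) = cong (⟦ pull C f i j ⟧ +_) (count-map C f ps)

count-filter : ∀ C (f : Pt → Bool) ps → count C ps ≡ count C (filterᵇ f ps) + count C (filterᵇ (not ∘ f) ps)
count-filter C f []             = refl
count-filter C f (p@(i , j) ∷ ps) with f p
... | true  = trans (cong (⟦ C i j ⟧ +_) (count-filter C f ps)) (sym (+-assoc ⟦ C i j ⟧ _ _))
... | false = trans (cong (⟦ C i j ⟧ +_) (count-filter C f ps)) (insert ⟦ C i j ⟧ (count C (filterᵇ f ps)) _)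
  where
  insert : ∀ x a b → x + (a + b) ≡ a + (x + b)
  insert = solve-∀

Affine : (Pt → Pt) → Set
Affine f = ∀ C → APFree C → APFree (pull C f)

up right swap : Pt → Pt
up    (i , j) = i , suc j
right (i , j) = suc i , j
swap  (i , j) = j , i

suc-middle : ∀ {a b c} → a + c ≡ b + b → suc a + suc c ≡ suc b + suc b
suc-middle {a} {b} {c} eq = trans (cong suc (+-suc a c)) (trans (cong (λ x → suc (suc x)) eq) (sym (cong suc (+-suc b b))))

up-affine : Affine up
up-affine C free i₁ j₁ i₂ j₂ i₃ j₃ c₁ c₂ c₃ ei ej =
  let e , e′ = free i₁ (suc j₁) i₂ (suc j₂) i₃ (suc j₃) c₁ c₂ c₃ ei (suc-middle {j₁} {j₂} {j₃} ej) in e , suc-injective e′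

right-affine : Affine right
right-affine C free i₁ j₁ i₂ j₂ i₃ j₃ c₁ c₂ c₃ ei ej =
  let e , e′ = free (suc i₁) j₁ (suc i₂) j₂ (suc i₃) j₃ c₁ c₂ c₃ (suc-middle {i₁} {i₂} {i₃} ei) ej in suc-injective e , e′

swap-affine : Affine swap
swap-affine C free i₁ j₁ i₂ j₂ i₃ j₃ c₁ c₂ c₃ ei ej =
  let e , e′ = free j₁ i₁ j₂ i₂ j₃ i₃ c₁ c₂ c₃ ej ei in e′ , e

AllValid-drop : ∀ n L → AllValid L → Valid (drop n L)
AllValid-drop zero    []      _        C _ = z≤n
AllValid-drop zero    (x ∷ L) (v , _)      = v
AllValid-drop (suc n) []      _        C _ = z≤n
AllValid-drop (suc n) (x ∷ L) (_ , vs)     = AllValid-drop n L vs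

module Verify (W M : ℕ) .{{_ : NonZero W}} (strip : Cert) where
  open Search W M

  allGood : List Pt → Bool
  allGood []       = true
  allGood (p ∷ ps) = good p ∧ allGood ps

  allGood-sound : ∀ ps → allGood ps ≡ true → All Good ps
  allGood-sound []       _  = []
  allGood-sound (p ∷ ps) ok = let g , gs = ∧-true {good p} ok in g ∷ allGood-sound ps gs

  edge inside : (Pt → Bool) → Pt → Cert → List Pt
  edge   f p L = filterᵇ f (p ∷ points L)
  inside f p L = filterᵇ (not ∘ f) (p ∷ points L)

  smaller : (Pt → Bool) → Pt → Cert → Cert
  smaller f p L = drop (length L ∸ length (inside f p L)) L

  strip-part : (Pt → Bool) → Pt → Cert → Cert
  strip-part f p L = drop (length strip ∸ length (edge f p L)) strip

  -- Off the bottom row, the points with 2ⁱ3ʲ ≤ x are the shift of those with 2ⁱ3ʲ ≤ x / 3, again a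
  -- tail of the list; similarly for the left column and x / 2. `smaller` and `strip-part` guess the
  -- tails from their lengths, and the comparisons here check the guess.
  cover : (Pt → Bool) → (Pt → Pt) → (Pt → Pt) → Pt → Cert → Bool
  cover f lift embed p L = (inside f p L =ᵖ map lift (points (smaller f p L))) ∧
    (edge f p L =ᵖ map embed (points (strip-part f p L))) ∧ (bound (strip-part f p L) + bound (smaller f p L) ≤ᵇ bound L)

  -- A head that is not a hit claims not to raise the maximum. Sets avoiding `p` obey the bound of
  -- the tail, so the search starts with `p` chosen and looks for `bound L` further points; 31 is
  -- the limit of `run-sound`, with `p` counted.
  justified : Kind → Pt → Cert → Bool
  justified hit    p L = true
  justified search p L = allGood (p ∷ points L) ∧ (bound L <ᵇ 31) ∧ run L (bound L) (p ∷ [])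
  justified row    p L = cover (λ q → proj₂ q ≡ᵇ 0) up (λ q → q) p L
  justified col    p L = cover (λ q → proj₁ q ≡ᵇ 0) right swap p L

  verify : Cert → Bool
  verify []            = true
  verify ((k , p) ∷ L) = justified k p L ∧ verify L

  module _ (strip-valid : AllValid strip) where

    cover-sound : ∀ f {lift embed} p L → Affine lift → Affine embed → AllValid L → cover f lift embed p L ≡ true →
      ∀ C → APFree C → count C (p ∷ points L) ≤ bound L
    cover-sound f {lift} {embed} p L affine affine′ vs ok C free =
      let i , ok′ = ∧-true {inside f p L =ᵖ map lift (points (smaller f p L))} ok
          e , b = ∧-true {edge f p L =ᵖ map embed (points (strip-part f p L))} ok′
      in ≤-trans (≤-reflexive (trans (count-filter C f (p ∷ points L)) (cong₂ _+_
             (trans (cong (count C) (=ᵖ-sound (edge f p L) _ e)) (count-map C embed (points (strip-part f p L))))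
             (trans (cong (count C) (=ᵖ-sound (inside f p L) _ i)) (count-map C lift (points (smaller f p L)))))))
           (≤-trans (+-mono-≤ (AllValid-drop (length strip ∸ length (edge f p L)) strip strip-valid (pull C embed) (affine′ C free))
                              (AllValid-drop (length L ∸ length (inside f p L)) L vs (pull C lift) (affine C free)))
             (≤ᵇ≡⇒≤ b))

    search-sound : ∀ p L → AllValid L → decreasing (p ∷ points L) ≡ true → justified search p L ≡ true →
      ∀ C → APFree C → count C (p ∷ points L) ≤ bound L
    search-sound p L vs dec ok C free with ∧-true {allGood (p ∷ points L)} ok
    ... | g , ok′ with allGood-sound (p ∷ points L) g | ∧-true {bound L <ᵇ 31} ok′
    ... | gp ∷ gs | small , found with C (proj₁ p) (proj₂ p) in eqC
    ... | false = valid L vs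
      where valid : ∀ L → AllValid L → count C (points L) ≤ bound L
            valid []      _       = z≤n
            valid (x ∷ L) (v , _) = v C free
    ... | true  = run-sound free L (bound L) (p ∷ []) vs (decreasing-tail p (points L) dec) gs
      ((chosen eqC gp , decreasing-below p (points L) dec) ∷ []) (<ᵇ⇒< (bound L) 31 (true⇒T small)) found

    verify-sound : ∀ L → decreasing (points L) ≡ true → verify L ≡ true → AllValid L
    verify-sound []            _   _  = tt
    verify-sound ((k , p) ∷ L) dec ok with ∧-true {justified k p L} ok
    ... | j , ok′ with verify-sound L (decreasing-tail p (points L) dec) ok′
    ... | vs = head k j , vs
      where
      valid : ∀ L → AllValid L → Valid L
      valid []      _       C free = z≤n
      valid (x ∷ L) (v , _) = v
      head : ∀ k → justified k p L ≡ true → Valid ((k , p) ∷ L)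
      head hit    _ C free = +-mono-≤ (⟦⟧≤1 (C (proj₁ p) (proj₂ p))) (valid L vs C free)
      head search j C free = search-sound p L vs dec j C free
      head row    j C free = cover-sound (λ q → proj₂ q ≡ᵇ 0) p L up-affine (λ _ f → f) vs j C free
      head col    j C free = cover-sound (λ q → proj₁ q ≡ᵇ 0) p L right-affine swap-affine vs j C free

-- Certified upper bounds

-- One-dimensional bounds: the hits are the places where the largest size of an AP-free set of n
-- consecutive integers grows, for n ≤ 20. Twenty points suffice for the longest row, which ends at
-- (19 , 0).
strip : Cert
strip =
  (hit , 19 , 0) ∷ (search , 18 , 0) ∷ (search , 17 , 0) ∷ (search , 16 , 0) ∷ (search , 15 , 0) ∷
  (search , 14 , 0) ∷ (hit , 13 , 0) ∷ (hit , 12 , 0) ∷ (search , 11 , 0) ∷ (hit , 10 , 0) ∷ (search , 9 , 0) ∷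
  (hit , 8 , 0) ∷ (search , 7 , 0) ∷ (search , 6 , 0) ∷ (search , 5 , 0) ∷ (hit , 4 , 0) ∷ (hit , 3 , 0) ∷
  (search , 2 , 0) ∷ (hit , 1 , 0) ∷ (hit , 0 , 0) ∷ []

-- All 140 points with 2ⁱ3ʲ ≤ 2¹⁵3³.
grid-cert : Cert
grid-cert =
  (row , 15 , 3) ∷ (hit , 7 , 8) ∷ (row , 18 , 1) ∷ (hit , 10 , 6) ∷ (row , 2 , 11) ∷ (row , 13 , 4) ∷
  (hit , 5 , 9) ∷ (row , 16 , 2) ∷ (hit , 8 , 7) ∷ (row , 0 , 12) ∷ (hit , 19 , 0) ∷ (hit , 11 , 5) ∷
  (row , 3 , 10) ∷ (row , 14 , 3) ∷ (hit , 6 , 8) ∷ (row , 17 , 1) ∷ (hit , 9 , 6) ∷ (row , 1 , 11) ∷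
  (row , 12 , 4) ∷ (hit , 4 , 9) ∷ (row , 15 , 2) ∷ (hit , 7 , 7) ∷ (row , 18 , 0) ∷ (hit , 10 , 5) ∷
  (row , 2 , 10) ∷ (row , 13 , 3) ∷ (hit , 5 , 8) ∷ (row , 16 , 1) ∷ (hit , 8 , 6) ∷ (row , 0 , 11) ∷
  (hit , 11 , 4) ∷ (row , 3 , 9) ∷ (row , 14 , 2) ∷ (hit , 6 , 7) ∷ (row , 17 , 0) ∷ (hit , 9 , 5) ∷ (row , 1 , 10) ∷
  (row , 12 , 3) ∷ (hit , 4 , 8) ∷ (row , 15 , 1) ∷ (hit , 7 , 6) ∷ (hit , 10 , 4) ∷ (row , 2 , 9) ∷ (row , 13 , 2) ∷
  (hit , 5 , 7) ∷ (row , 16 , 0) ∷ (hit , 8 , 5) ∷ (row , 0 , 10) ∷ (hit , 11 , 3) ∷ (col , 3 , 8) ∷ (col , 14 , 1) ∷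
  (hit , 6 , 6) ∷ (hit , 9 , 4) ∷ (col , 1 , 9) ∷ (col , 12 , 2) ∷ (hit , 4 , 7) ∷ (col , 15 , 0) ∷ (hit , 7 , 5) ∷
  (hit , 10 , 3) ∷ (col , 2 , 8) ∷ (col , 13 , 1) ∷ (hit , 5 , 6) ∷ (hit , 8 , 4) ∷ (row , 0 , 9) ∷ (row , 11 , 2) ∷
  (hit , 3 , 7) ∷ (row , 14 , 0) ∷ (hit , 6 , 5) ∷ (hit , 9 , 3) ∷ (col , 1 , 8) ∷ (col , 12 , 1) ∷ (hit , 4 , 6) ∷
  (col , 7 , 4) ∷ (hit , 10 , 2) ∷ (col , 2 , 7) ∷ (hit , 13 , 0) ∷ (hit , 5 , 5) ∷ (hit , 8 , 3) ∷
  (search , 0 , 8) ∷ (search , 11 , 1) ∷ (hit , 3 , 6) ∷ (search , 6 , 4) ∷ (hit , 9 , 2) ∷ (search , 1 , 7) ∷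
  (search , 12 , 0) ∷ (hit , 4 , 5) ∷ (search , 7 , 3) ∷ (hit , 10 , 1) ∷ (search , 2 , 6) ∷ (hit , 5 , 4) ∷
  (search , 8 , 2) ∷ (col , 0 , 7) ∷ (col , 11 , 0) ∷ (hit , 3 , 5) ∷ (hit , 6 , 3) ∷ (search , 9 , 1) ∷
  (hit , 1 , 6) ∷ (search , 4 , 4) ∷ (hit , 7 , 2) ∷ (search , 10 , 0) ∷ (search , 2 , 5) ∷ (search , 5 , 3) ∷
  (hit , 8 , 1) ∷ (search , 0 , 6) ∷ (hit , 3 , 4) ∷ (search , 6 , 2) ∷ (search , 9 , 0) ∷ (search , 1 , 5) ∷
  (hit , 4 , 3) ∷ (search , 7 , 1) ∷ (hit , 2 , 4) ∷ (search , 5 , 2) ∷ (search , 8 , 0) ∷ (search , 0 , 5) ∷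
  (hit , 3 , 3) ∷ (search , 6 , 1) ∷ (hit , 1 , 4) ∷ (search , 4 , 2) ∷ (row , 7 , 0) ∷ (hit , 2 , 3) ∷
  (search , 5 , 1) ∷ (search , 0 , 4) ∷ (hit , 3 , 2) ∷ (row , 6 , 0) ∷ (hit , 1 , 3) ∷ (hit , 4 , 1) ∷
  (search , 2 , 2) ∷ (search , 5 , 0) ∷ (hit , 0 , 3) ∷ (hit , 3 , 1) ∷ (search , 1 , 2) ∷ (search , 4 , 0) ∷
  (hit , 2 , 1) ∷ (col , 0 , 2) ∷ (hit , 3 , 0) ∷ (hit , 1 , 1) ∷ (row , 2 , 0) ∷ (hit , 0 , 1) ∷ (hit , 1 , 0) ∷
  (hit , 0 , 0) ∷ []

strip-verified : Verify.verify 40 20 [] strip ≡ true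
strip-verified = refl

-- Searches only concern points up to 3⁸, so i ≤ 12 and 2 · 12 < 27; 216 = 27 · 8 is the code of (0
-- , 8), the largest one there.
grid-verified : Verify.verify 27 216 strip grid-cert ≡ true
grid-verified = refl

-- Comparing prefixes class by class

total : ∀ {E : Set} → (E → ℕ) → List E → ℕ
total f []       = 0
total f (x ∷ xs) = f x + total f xs

total-*ˡ : ∀ {E : Set} c (f : E → ℕ) xs → total (λ x → c * f x) xs ≡ c * total f xs
total-*ˡ c f []       = sym (*-zeroʳ c)
total-*ˡ c f (x ∷ xs) = trans (cong (c * f x +_) (total-*ˡ c f xs)) (sym (*-distribˡ-+ c (f x) _))

total-∑ : ∀ {E : Set} n (f : E → ℕ → ℕ) xs → total (λ x → ∑ n (f x)) xs ≡ ∑ n (λ b → total (λ x → f x b) xs)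
total-∑ n f []       = sym (∑-zero n (λ _ _ → refl))
total-∑ n f (x ∷ xs) = trans (cong (∑ n (f x) +_) (total-∑ n f xs)) (sym (∑-+ n (f x) _))

at : ∀ {A : Set} → (ℕ → ℕ → A) → Pt → A
at f (i , j) = f i j

multiplicity : List Pt → ℕ → ℕ → ℕ
multiplicity ps i j = total (at λ i′ j′ → ⟦ i ≡ᵇ i′ ⟧ * ⟦ j ≡ᵇ j′ ⟧) ps

multiplicity-zero : ∀ ps {i j} → All (λ p → val p ≢ smooth i j) ps → multiplicity ps i j ≡ 0
multiplicity-zero []               []        = refl
multiplicity-zero ((i′ , j′) ∷ ps) {i} {j} (v≢ ∷ a) with i ≟ i′ | j ≟ j′
... | yes refl | yes refl = ⊥-elim (v≢ refl)
... | no i≢    | _        rewrite ≢⇒≡ᵇ i≢ = multiplicity-zero ps {i} {j} a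
... | yes _    | no j≢    rewrite ≢⇒≡ᵇ j≢ | *-zeroʳ ⟦ i ≡ᵇ i′ ⟧ = multiplicity-zero ps {i} {j} a

multiplicity≤1 : ∀ ps i j → decreasing ps ≡ true → multiplicity ps i j ≤ 1
multiplicity≤1 []               i j _ = z≤n
multiplicity≤1 ((i′ , j′) ∷ ps) i j d with i ≟ i′ | j ≟ j′
... | yes refl | yes refl rewrite ≡ᵇ-refl i | ≡ᵇ-refl j
      | multiplicity-zero ps {i} {j} (All.map <⇒≢ (decreasing-below (i , j) ps d)) = ≤-refl
... | no i≢    | _        rewrite ≢⇒≡ᵇ i≢ = multiplicity≤1 ps i j (decreasing-tail (i′ , j′) ps d)
... | yes _    | no j≢    rewrite ≢⇒≡ᵇ j≢ | *-zeroʳ ⟦ i ≡ᵇ i′ ⟧ = multiplicity≤1 ps i j (decreasing-tail (i′ , j′) ps d)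

grid-δ : ∀ D (f : ℕ → ℕ → ℕ) p → proj₁ p < D → proj₂ p < D →
  at f p ≡ grid D (λ i j → at (λ i′ j′ → ⟦ i ≡ᵇ i′ ⟧ * ⟦ j ≡ᵇ j′ ⟧) p * f i j)
grid-δ D f (i′ , j′) i< j< = sym (trans
  (∑-cong D (λ i _ → trans (∑-cong D (λ j _ → *-assoc ⟦ i ≡ᵇ i′ ⟧ _ _)) (trans (∑-*ˡ D ⟦ i ≡ᵇ i′ ⟧ _) (cong (⟦ i ≡ᵇ i′ ⟧ *_) (∑-δ D j′ (f i) j<)))))
  (∑-δ D i′ (λ i → f i j′) i<))

grid-multiplicity : ∀ D (f : ℕ → ℕ → ℕ) ps → All (λ p → proj₁ p < D × proj₂ p < D) ps →
  total (at f) ps ≡ grid D (λ i j → multiplicity ps i j * f i j)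
grid-multiplicity D f []       []              = sym (∑-zero D (λ i _ → ∑-zero D (λ j _ → refl)))
grid-multiplicity D f (p ∷ ps) ((i< , j<) ∷ a) = trans
  (cong₂ _+_ (grid-δ D f p i< j<) (grid-multiplicity D f ps a))
  (trans (sym (grid-+ D _ _)) (grid-cong D (λ i j _ _ → sym (*-distribʳ-+ (f i j) (at (λ i′ j′ → ⟦ i ≡ᵇ i′ ⟧ * ⟦ j ≡ᵇ j′ ⟧) p) (multiplicity ps i j)))))

-- Strictly decreasing values make the points distinct, so no cell is counted twice.
total≤grid : ∀ D (f : ℕ → ℕ → ℕ) ps → decreasing ps ≡ true → All (λ p → proj₁ p < D × proj₂ p < D) ps →
  total (at f) ps ≤ grid D f
total≤grid D f ps d a = ≤-trans (≤-reflexive (grid-multiplicity D f ps a))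
  (grid-mono D (λ i j _ _ → ≤-trans (*-monoˡ-≤ (f i j) (multiplicity≤1 ps i j d)) (≤-reflexive (*-identityˡ (f i j)))))

total-map : ∀ {E F : Set} (pt : E → F) (f : F → ℕ) xs → total f (map pt xs) ≡ total (f ∘ pt) xs
total-map pt f []       = refl
total-map pt f (x ∷ xs) = cong (f (pt x) +_) (total-map pt f xs)

-- Used twice: with misses compared to absence from an optimal set, and with gains compared to
-- presence in a constructed set.
module Weighted {E : Set} (pt : E → Pt) (weight-of : E → ℕ) where

  Dominated : (E → ℕ) → List E → Set
  Dominated f []       = ⊤
  Dominated f (x ∷ xs) = total weight-of (x ∷ xs) ≤ total f (x ∷ xs) × Dominated f xs

  reach : ℕ → ℕ → E → ℕ
  reach N b x = ⟦ val (pt x) * b ≤ᵇ N ⟧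

  reach-all : ∀ N b (f : E → ℕ) x xs → decreasing (map pt (x ∷ xs)) ≡ true → val (pt x) * b ≤ N →
    total (λ y → reach N b y * f y) (x ∷ xs) ≡ total f (x ∷ xs)
  reach-all N b f x xs dec le = cong₂ _+_ (trans (cong (λ t → ⟦ t ⟧ * f x) (≤⇒≤ᵇ≡ le)) (*-identityˡ (f x))) (rest xs dec)
    where
    rest : ∀ xs → decreasing (map pt (x ∷ xs)) ≡ true → total (λ y → reach N b y * f y) xs ≡ total f xs
    rest []       _   = refl
    rest (y ∷ ys) dec = reach-all N b f y ys (decreasing-tail (pt x) (map pt (y ∷ ys)) dec)
      (≤-trans (*-monoˡ-≤ b (<⇒≤ (<ᵇ⇒< (val (pt y)) (val (pt x)) (true⇒T (proj₁ (∧-true {val (pt y) <ᵇ val (pt x)} dec)))))) le)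

  -- As values decrease, once an entry is reached so are all later ones: the reached entries form a
  -- tail, and `Dominated` has an inequality for each tail.
  reach-dominated : ∀ N b (f : E → ℕ) xs → decreasing (map pt xs) ≡ true → Dominated f xs →
    total (λ x → reach N b x * weight-of x) xs ≤ total (λ x → reach N b x * f x) xs
  reach-dominated N b f []       _   _         = z≤n
  reach-dominated N b f (x ∷ xs) dec (le , ds) with val (pt x) * b ≤? N
  ... | yes ok = ≤-trans (≤-reflexive (reach-all N b weight-of x xs dec ok)) (≤-trans le (≤-reflexive (sym (reach-all N b f x xs dec ok))))
  ... | no ¬ok rewrite ≰⇒≤ᵇ≡ ¬ok = reach-dominated N b f xs (decreasing-tail (pt x) (map pt xs) dec) ds

  module _ (D N : ℕ) (N≤D : N ≤ D) (xs : List E) (dec : decreasing (map pt xs) ≡ true)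
           (small : All (λ p → proj₁ p < D × proj₂ p < D) (map pt xs)) where

    -- The sums over entries and over cores are interchanged; within a class, the cells outside the
    -- list contribute nonnegative terms and are dropped.
    classwise : ∀ (φ : ℕ → ℕ) →
      (∀ b → rough (suc b) ≡ true → total (λ x → reach N (suc b) x * weight-of x) xs ≤
                                  total (λ x → reach N (suc b) x * φ (val (pt x) * suc b)) xs) →
      total (λ x → weight-of x * ρ D N (val (pt x))) xs ≤ ∑ N (λ k → φ (suc k))
    classwise φ le = ≤-trans (≤-reflexive swapped) (≤-trans (∑-mono D (λ b _ → class-le b)) (≤-reflexive (sym (by-class D N φ N≤D))))
      where
      swapped : total (λ x → weight-of x * ρ D N (val (pt x))) xs ≡
        ∑ D (λ b → ⟦ rough (suc b) ⟧ * total (λ x → reach N (suc b) x * weight-of x) xs)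
      swapped = trans (total-cong xs (λ x → trans (sym (∑-*ˡ D (weight-of x) _)) (∑-cong D (λ b _ → rearrange (weight-of x) ⟦ rough (suc b) ⟧ _))))
        (trans (total-∑ D (λ x b → ⟦ rough (suc b) ⟧ * (reach N (suc b) x * weight-of x)) xs)
          (∑-cong D (λ b _ → total-*ˡ ⟦ rough (suc b) ⟧ _ xs)))
        where
        rearrange : ∀ w r t → w * (r * t) ≡ r * (t * w)
        rearrange = solve-∀
        total-cong : ∀ xs {f h : E → ℕ} → (∀ x → f x ≡ h x) → total f xs ≡ total h xs
        total-cong []       eq = refl
        total-cong (x ∷ xs) eq = cong₂ _+_ (eq x) (total-cong xs eq)
      class-le : ∀ b → ⟦ rough (suc b) ⟧ * total (λ x → reach N (suc b) x * weight-of x) xs ≤ ⟦ rough (suc b) ⟧ * slice φ D N (suc b)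
      class-le b with rough (suc b) in r
      ... | false = z≤n
      ... | true  = *-monoʳ-≤ 1 (≤-trans (le b r) (≤-trans
              (≤-reflexive (trans (total-at xs) (sym (total-map pt (at (λ i j → ⟦ smooth i j * suc b ≤ᵇ N ⟧ * φ (smooth i j * suc b))) xs))))
              (total≤grid D (λ i j → ⟦ smooth i j * suc b ≤ᵇ N ⟧ * φ (smooth i j * suc b)) (map pt xs) dec small)))
        where
        total-at : ∀ xs → total (λ x → reach N (suc b) x * φ (val (pt x) * suc b)) xs ≡
          total (λ x → at (λ i j → ⟦ smooth i j * suc b ≤ᵇ N ⟧ * φ (smooth i j * suc b)) (pt x)) xs
        total-at []       = refl
        total-at (x ∷ xs) = cong₂ _+_ refl (total-at xs)

    -- `ρ-lower` is applied entry by entry. Each entry loses at most its own weight, which accounts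
    -- for the last summand.
    density : ∀ K → All (λ p → proj₁ p ≤ K × proj₂ p ≤ K) (map pt xs) →
      N * total (λ x → weight-of x * at (weight K) (pt x)) xs ≤
      3 * smooth K K * (total (λ x → weight-of x * ρ D N (val (pt x))) xs + total weight-of xs)
    density K bounded = go-density xs bounded
      where
      cell : ∀ l w t r Q → w * t ≡ Q → N ≤ 3 * t * r + 3 * t → N * (l * w) ≤ 3 * Q * (l * r + l)
      cell l w t r Q refl le = ≤-trans (≤-reflexive (*-comm N (l * w))) (≤-trans (*-monoʳ-≤ (l * w) le) (≤-reflexive (e l w t r)))
        where e : ∀ l w t r → l * w * (3 * t * r + 3 * t) ≡ 3 * (w * t) * (l * r + l)
              e = solve-∀
      go-density : ∀ xs → All (λ p → proj₁ p ≤ K × proj₂ p ≤ K) (map pt xs) →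
        N * total (λ x → weight-of x * at (weight K) (pt x)) xs ≤
        3 * smooth K K * (total (λ x → weight-of x * ρ D N (val (pt x))) xs + total weight-of xs)
      go-density []       []              = ≤-reflexive (trans (*-zeroʳ N) (sym (*-zeroʳ (3 * smooth K K))))
      go-density (x ∷ xs) ((i≤ , j≤) ∷ a) = ≤-trans (≤-reflexive (*-distribˡ-+ N _ _))
        (≤-trans (+-mono-≤ (cell (weight-of x) (at (weight K) (pt x)) (val (pt x)) (ρ D N (val (pt x))) (smooth K K)
                              (weight-s {K} i≤ j≤) (ρ-lower D N (val (pt x)) {{>-nonZero (s≥1 (proj₁ (pt x)) (proj₂ (pt x)))}} N≤D))
                            (go-density xs a))
          (≤-reflexive (e (3 * smooth K K) (weight-of x * ρ D N (val (pt x))) (weight-of x) _ _)))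
        where e : ∀ Q a b c d → Q * (a + b) + Q * (c + d) ≡ Q * (a + c + (b + d))
              e = solve-∀

length-split : ∀ C L → count C (points L) + total (λ x → ⟦ not (at C (proj₂ x)) ⟧) L ≡ length L
length-split C []                  = refl
length-split C ((k , i , j) ∷ L) = trans (interchange ⟦ C i j ⟧ _ ⟦ not (C i j) ⟧ _) (cong₂ _+_ (⟦⟧+not (C i j)) (length-split C L))

miss : Kind × Pt → ℕ
miss (hit , _) = 0
miss _         = 1

-- This identifies `miss` with the increments d_k of the overview.
length-bound : ∀ L → bound L + total miss L ≡ length L
length-bound []                 = refl
length-bound ((hit    , _) ∷ L) = cong suc (length-bound L)
length-bound ((search , _) ∷ L) = trans (+-suc (bound L) _) (cong suc (length-bound L))
length-bound ((row    , _) ∷ L) = trans (+-suc (bound L) _) (cong suc (length-bound L))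
length-bound ((col    , _) ∷ L) = trans (+-suc (bound L) _) (cong suc (length-bound L))

allBelow : ℕ → List Pt → Bool
allBelow K []             = true
allBelow K ((i , j) ∷ ps) = (i ≤ᵇ K) ∧ (j ≤ᵇ K) ∧ allBelow K ps

allBelow-sound : ∀ K ps → allBelow K ps ≡ true → All (λ p → proj₁ p ≤ K × proj₂ p ≤ K) ps
allBelow-sound K []             _  = []
allBelow-sound K ((i , j) ∷ ps) ok =
  let a , ok′ = ∧-true {i ≤ᵇ K} ok
      b , c = ∧-true {j ≤ᵇ K} ok′
  in (≤ᵇ≡⇒≤ a , ≤ᵇ≡⇒≤ b) ∷ allBelow-sound K ps c

module _ {g : ℕ → ℕ} (G : ∀ N → IsG3 N (g N)) where

  module Upper (L : Cert) (valid : AllValid L) (dec : decreasing (points L) ≡ true) (K : ℕ) (bounded : allBelow K (points L) ≡ true) where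
    open Weighted {E = Kind × Pt} proj₂ miss

    -- Subtracting from the length turns an upper bound on present points into a lower bound on
    -- absent ones, tail by tail.
    miss-dominated : ∀ C → APFree C → ∀ L → AllValid L → Dominated (λ x → ⟦ not (at C (proj₂ x)) ⟧) L
    miss-dominated C free []      _        = tt
    miss-dominated C free (x ∷ L) (v , vs) = +-cancelˡ-≤ (bound (x ∷ L)) _ _
      (≤-trans (≤-reflexive (trans (length-bound (x ∷ L)) (sym (length-split C (x ∷ L))))) (+-monoˡ-≤ _ (v C free))) ,
      miss-dominated C free L vs

    upper : ∀ N → ∃[ r ] (g N + r ≡ N × N * total (λ x → miss x * at (weight K) (proj₂ x)) L ≤ 3 * smooth K K * (r + total miss L))
    upper N = absent , covers ,
      ≤-trans (density D N (m≤m+n N _) L dec small K (allBelow-sound K (points L) bounded))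
        (*-monoʳ-≤ (3 * smooth K K) (+-monoˡ-≤ (total miss L) (classwise D N (m≤m+n N _) L dec small (λ n → ⟦ not (set n) ⟧)
          (λ b r → reach-dominated N (suc b) _ L dec (miss-dominated (class set (suc b)) (class-APFree {set} (s≤s z≤n) free) L valid)))))
      where
      open Optimum (optimum (G N))
      D : ℕ
      D = N + suc K
      small : All (λ p → proj₁ p < D × proj₂ p < D) (points L)
      small = All.map (λ { (i≤ , j≤) → ≤-trans (s≤s i≤) (m≤n+m (suc K) N) , ≤-trans (s≤s j≤) (m≤n+m (suc K) N) }) (allBelow-sound K (points L) bounded)
      absent : ℕ
      absent = ∑ N (λ k → ⟦ not (set (suc k)) ⟧)
      covers : g N + absent ≡ N
      covers = trans (cong (_+ absent) (sym size)) (trans (sym (∑-+ N _ _)) (trans (∑-cong N (λ k _ → ⟦⟧+not (set (suc k)))) (∑-one N)))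
        where ∑-one : ∀ N → ∑ N (λ _ → 1) ≡ N
              ∑-one zero    = refl
              ∑-one (suc N) = trans (cong (_+ 1) (∑-one N)) (+-comm N 1)

-- Lower bounds from explicit AP-free sets

_∈ᵇ_ : Pt → List Pt → Bool
p ∈ᵇ []                         = false
(i , j) ∈ᵇ ((i′ , j′) ∷ ps) = ((i ≡ᵇ i′) ∧ (j ≡ᵇ j′)) ∨ ((i , j) ∈ᵇ ps)

allᵖ : (Pt → Bool) → List Pt → Bool
allᵖ f []       = true
allᵖ f (p ∷ ps) = f p ∧ allᵖ f ps

allᵖ-∈ : ∀ f ps p → allᵖ f ps ≡ true → (p ∈ᵇ ps) ≡ true → f p ≡ true
allᵖ-∈ f ((i′ , j′) ∷ ps) (i , j) ok mem with i ≟ i′ | j ≟ j′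
... | yes refl | yes refl = proj₁ (∧-true ok)
... | no i≢ | _ rewrite ≢⇒≡ᵇ i≢ = allᵖ-∈ f ps (i , j) (proj₂ (∧-true {f (i′ , j′)} ok)) mem
... | yes refl | no j≢ rewrite ≡ᵇ-refl i | ≢⇒≡ᵇ j≢ = allᵖ-∈ f ps (i , j) (proj₂ (∧-true {f (i , j′)} ok)) mem

trivial : Pt → Pt → Pt → Bool
trivial (i₁ , j₁) (i₂ , j₂) (i₃ , j₃) =
  not ((i₁ + i₃ ≡ᵇ i₂ + i₂) ∧ (j₁ + j₃ ≡ᵇ j₂ + j₂)) ∨ ((i₁ ≡ᵇ i₃) ∧ (j₁ ≡ᵇ j₃))

progressionFree : List Pt → Bool
progressionFree ps = allᵖ (λ p → allᵖ (λ q → allᵖ (trivial p q) ps) ps) ps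

indicator : List Pt → ℕ → ℕ → Bool
indicator ps i j = (i , j) ∈ᵇ ps

progressionFree-sound : ∀ ps → progressionFree ps ≡ true → APFree (indicator ps)
progressionFree-sound ps ok i₁ j₁ i₂ j₂ i₃ j₃ m₁ m₂ m₃ ei ej
  with allᵖ-∈ _ ps (i₃ , j₃) (allᵖ-∈ _ ps (i₂ , j₂) (allᵖ-∈ _ ps (i₁ , j₁) ok m₁) m₂) m₃
... | t rewrite ei | ej | ≡ᵇ-refl (i₂ + i₂) | ≡ᵇ-refl (j₂ + j₂) =
  let a , b = ∧-true {i₁ ≡ᵇ i₃} t in ≡ᵇ⇒≡ i₁ i₃ (true⇒T a) , ≡ᵇ⇒≡ j₁ j₃ (true⇒T b)

nth : List (List Pt) → ℕ → List Pt
nth []         _       = []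
nth (ps ∷ pss) zero    = ps
nth (ps ∷ pss) (suc n) = nth pss n

allFree : List (List Pt) → Bool
allFree []         = true
allFree (ps ∷ pss) = progressionFree ps ∧ allFree pss

nth-APFree : ∀ pss n → allFree pss ≡ true → APFree (indicator (nth pss n))
nth-APFree []         n       _  = λ _ _ _ _ _ _ ()
nth-APFree (ps ∷ pss) zero    ok = progressionFree-sound ps (proj₁ (∧-true ok))
nth-APFree (ps ∷ pss) (suc n) ok = nth-APFree pss n (proj₂ (∧-true {progressionFree ps} ok))

module Lower (sets : List (List Pt)) where

  -- In `(s , l , n)`, the number `n` names the set taken by every class whose largest reached
  -- listed point is `s`, and `l` is the weight of `s` in the bound. `supported` asks each set to
  -- cover the weights from its entry down.
  Entry : Set
  Entry = Pt × ℕ × ℕ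

  gain : Entry → ℕ
  gain (_ , l , _) = l

  chosen-set : Entry → ℕ → ℕ → Bool
  chosen-set (_ , _ , n) = indicator (nth sets n)

  supported : List Entry → Bool
  supported []       = true
  supported (x ∷ xs) = (total gain (x ∷ xs) ≤ᵇ total (λ y → ⟦ at (chosen-set x) (proj₁ y) ⟧) (x ∷ xs)) ∧ supported xs

  open Weighted {E = Entry} proj₁ gain

  choose : ℕ → ℕ → List Entry → ℕ → ℕ → Bool
  choose N b []       = λ _ _ → false
  choose N b (x ∷ xs) = if val (proj₁ x) * b ≤ᵇ N then chosen-set x else choose N b xs

  choose-APFree : allFree sets ≡ true → ∀ N b xs → APFree (choose N b xs)
  choose-APFree ok N b []       = λ _ _ _ _ _ _ ()
  choose-APFree ok N b (x ∷ xs) with val (proj₁ x) * b ≤ᵇ N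
  ... | true  = nth-APFree sets (proj₂ (proj₂ x)) ok
  ... | false = choose-APFree ok N b xs

  choose-dominated : ∀ N b xs → decreasing (map proj₁ xs) ≡ true → supported xs ≡ true →
    total (λ x → reach N b x * gain x) xs ≤ total (λ x → reach N b x * ⟦ at (choose N b xs) (proj₁ x) ⟧) xs
  choose-dominated N b []       _   _  = z≤n
  choose-dominated N b (x ∷ xs) dec ok with val (proj₁ x) * b ≤? N
  ... | yes le rewrite ≤⇒≤ᵇ≡ le = ≤-trans (≤-reflexive (trans (cong₂ _+_ (cong (λ t → ⟦ t ⟧ * gain x) (sym (≤⇒≤ᵇ≡ le))) refl) (reach-all N b gain x xs dec le)))
      (≤-trans (≤ᵇ≡⇒≤ (proj₁ (∧-true {total gain (x ∷ xs) ≤ᵇ _} ok)))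
        (≤-reflexive (sym (trans (cong₂ _+_ (cong (λ t → ⟦ t ⟧ * ⟦ at (chosen-set x) (proj₁ x) ⟧) (sym (≤⇒≤ᵇ≡ le))) refl)
          (reach-all N b (λ y → ⟦ at (chosen-set x) (proj₁ y) ⟧) x xs dec le)))))
  ... | no ¬le rewrite ≰⇒≤ᵇ≡ ¬le = choose-dominated N b xs (decreasing-tail (proj₁ x) (map proj₁ xs) dec) (proj₂ (∧-true {total gain (x ∷ xs) ≤ᵇ _} ok))

  module _ {g : ℕ → ℕ} (G : ∀ N → IsG3 N (g N)) (L : List Entry) (dec : decreasing (map proj₁ L) ≡ true)
           (free : allFree sets ≡ true) (ok : supported L ≡ true) (K : ℕ) (bounded : allBelow K (map proj₁ L) ≡ true) where

    lower : ∀ N → N * total (λ x → gain x * at (weight K) (proj₁ x)) L ≤ 3 * smooth K K * (g N + total gain L)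
    lower N = ≤-trans (density D N (m≤m+n N _) L dec small K (allBelow-sound K (map proj₁ L) bounded))
      (*-monoʳ-≤ (3 * smooth K K) (+-monoˡ-≤ (total gain L)
        (≤-trans (classwise D N (m≤m+n N _) L dec small (λ n → ⟦ A n ⟧) class-le)
          (maximal (G N) A (assemble-Free (λ b _ → choose-APFree free N b L))))))
      where
      D : ℕ
      D = N + suc K
      small : All (λ p → proj₁ p < D × proj₂ p < D) (map proj₁ L)
      small = All.map (λ { (i≤ , j≤) → ≤-trans (s≤s i≤) (m≤n+m (suc K) N) , ≤-trans (s≤s j≤) (m≤n+m (suc K) N) }) (allBelow-sound K (map proj₁ L) bounded)
      A : ℕ → Bool
      A = assemble (λ b → choose N b L)
      class-le : ∀ b → rough (suc b) ≡ true → total (λ x → reach N (suc b) x * gain x) L ≤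
        total (λ x → reach N (suc b) x * ⟦ A (val (proj₁ x) * suc b) ⟧) L
      class-le b r = ≤-trans (choose-dominated N (suc b) L dec ok) (≤-reflexive (same L))
        where
        same : ∀ xs → total (λ x → reach N (suc b) x * ⟦ at (choose N (suc b) L) (proj₁ x) ⟧) xs ≡
          total (λ x → reach N (suc b) x * ⟦ A (val (proj₁ x) * suc b) ⟧) xs
        same []       = refl
        same (x ∷ xs) = cong₂ _+_ (cong (λ t → reach N (suc b) x * ⟦ t ⟧)
          (sym (assemble-at (λ b → choose N b L) (proj₁ (proj₁ x)) (proj₂ (proj₁ x)) (suc b) r))) (same xs)

-- Explicit sets

low-sets : List (List Pt)
low-sets =
  ((0 , 0) ∷ (1 , 0) ∷ (1 , 1) ∷ (3 , 0) ∷ (0 , 2) ∷ (2 , 1) ∷ []) ∷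
  ((0 , 0) ∷ (1 , 0) ∷ (0 , 1) ∷ (4 , 0) ∷ (1 , 2) ∷ (3 , 1) ∷ (0 , 3) ∷ (4 , 1) ∷ (1 , 3) ∷ (6 , 0) ∷
   (3 , 2) ∷ []) ∷
  ((1 , 0) ∷ (0 , 1) ∷ (1 , 1) ∷ (3 , 0) ∷ (0 , 2) ∷ (4 , 0) ∷ (4 , 1) ∷ (1 , 3) ∷ (6 , 0) ∷ (0 , 4) ∷
   (5 , 1) ∷ (2 , 3) ∷ []) ∷
  ((0 , 0) ∷ (0 , 1) ∷ (2 , 0) ∷ (1 , 1) ∷ (3 , 0) ∷ (0 , 3) ∷ (5 , 0) ∷ (4 , 1) ∷ (1 , 3) ∷ (0 , 4) ∷
   (5 , 1) ∷ (4 , 2) ∷ (1 , 4) ∷ []) ∷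
  ((0 , 0) ∷ (1 , 0) ∷ (1 , 1) ∷ (3 , 1) ∷ (0 , 3) ∷ (5 , 0) ∷ (4 , 1) ∷ (1 , 3) ∷ (6 , 0) ∷ (0 , 4) ∷
   (4 , 2) ∷ (1 , 4) ∷ (6 , 1) ∷ (3 , 3) ∷ []) ∷
  ((0 , 0) ∷ (1 , 0) ∷ (0 , 2) ∷ (2 , 1) ∷ (3 , 1) ∷ (0 , 3) ∷ (5 , 0) ∷ (5 , 1) ∷ (2 , 3) ∷ (7 , 0) ∷
   (1 , 4) ∷ (6 , 1) ∷ (3 , 3) ∷ (8 , 0) ∷ (2 , 4) ∷ []) ∷
  ((0 , 0) ∷ (1 , 0) ∷ (0 , 2) ∷ (2 , 1) ∷ (3 , 1) ∷ (0 , 3) ∷ (5 , 0) ∷ (2 , 2) ∷ (7 , 0) ∷ (1 , 4) ∷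
   (6 , 1) ∷ (3 , 3) ∷ (8 , 0) ∷ (2 , 4) ∷ (7 , 1) ∷ (4 , 3) ∷ []) ∷
  ((0 , 0) ∷ (1 , 0) ∷ (1 , 1) ∷ (0 , 2) ∷ (2 , 1) ∷ (0 , 3) ∷ (5 , 0) ∷ (5 , 1) ∷ (7 , 0) ∷ (1 , 4) ∷
   (6 , 1) ∷ (0 , 5) ∷ (8 , 0) ∷ (4 , 3) ∷ (1 , 5) ∷ (6 , 2) ∷ (3 , 4) ∷ []) ∷
  ((0 , 1) ∷ (1 , 1) ∷ (3 , 0) ∷ (0 , 2) ∷ (4 , 0) ∷ (1 , 2) ∷ (3 , 1) ∷ (4 , 2) ∷ (1 , 4) ∷ (3 , 3) ∷
   (0 , 5) ∷ (8 , 0) ∷ (7 , 1) ∷ (1 , 5) ∷ (9 , 0) ∷ (3 , 4) ∷ (0 , 6) ∷ (8 , 1) ∷ []) ∷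
  ((0 , 0) ∷ (0 , 1) ∷ (2 , 0) ∷ (1 , 1) ∷ (3 , 0) ∷ (0 , 4) ∷ (2 , 3) ∷ (7 , 0) ∷ (1 , 4) ∷ (6 , 1) ∷
   (3 , 3) ∷ (8 , 0) ∷ (1 , 5) ∷ (3 , 4) ∷ (0 , 6) ∷ (8 , 1) ∷ (2 , 5) ∷ (10 , 0) ∷ (7 , 2) ∷ []) ∷
  ((0 , 0) ∷ (1 , 0) ∷ (1 , 1) ∷ (3 , 0) ∷ (0 , 2) ∷ (3 , 1) ∷ (4 , 1) ∷ (7 , 0) ∷ (4 , 2) ∷ (3 , 3) ∷
   (0 , 5) ∷ (1 , 5) ∷ (9 , 0) ∷ (3 , 4) ∷ (0 , 6) ∷ (8 , 1) ∷ (10 , 0) ∷ (4 , 4) ∷ (1 , 6) ∷ (9 , 1) ∷ []) ∷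
  ((0 , 0) ∷ (2 , 0) ∷ (1 , 1) ∷ (3 , 0) ∷ (3 , 1) ∷ (0 , 3) ∷ (4 , 1) ∷ (1 , 3) ∷ (0 , 4) ∷ (1 , 4) ∷
   (8 , 0) ∷ (4 , 3) ∷ (3 , 4) ∷ (8 , 1) ∷ (5 , 3) ∷ (10 , 0) ∷ (1 , 6) ∷ (9 , 1) ∷ (3 , 5) ∷ (11 , 0) ∷
   (0 , 7) ∷ []) ∷
  ((0 , 0) ∷ (0 , 1) ∷ (2 , 0) ∷ (3 , 0) ∷ (2 , 1) ∷ (3 , 1) ∷ (0 , 4) ∷ (1 , 4) ∷ (3 , 3) ∷ (0 , 5) ∷
   (8 , 0) ∷ (7 , 1) ∷ (4 , 3) ∷ (2 , 5) ∷ (10 , 0) ∷ (4 , 4) ∷ (1 , 6) ∷ (9 , 1) ∷ (11 , 0) ∷ (5 , 4) ∷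
   (2 , 6) ∷ (10 , 1) ∷ (7 , 3) ∷ []) ∷
  ((0 , 0) ∷ (1 , 0) ∷ (1 , 1) ∷ (3 , 0) ∷ (0 , 2) ∷ (4 , 0) ∷ (3 , 1) ∷ (0 , 3) ∷ (4 , 1) ∷ (1 , 3) ∷
   (1 , 4) ∷ (0 , 5) ∷ (9 , 0) ∷ (3 , 4) ∷ (8 , 1) ∷ (5 , 3) ∷ (10 , 0) ∷ (4 , 4) ∷ (9 , 1) ∷ (7 , 3) ∷
   (4 , 5) ∷ (12 , 0) ∷ (6 , 4) ∷ (3 , 6) ∷ (11 , 1) ∷ []) ∷
  []

-- All 61 points with 2ⁱ3ʲ ≤ 2¹¹ · 3. A weight 1 marks growth of the certified size, which ends at
-- 25; one set may serve several ranges, counting only the points reached.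
low-entries : List (Lower.Entry low-sets)
low-entries =
  ((11 , 1) , 1 , 13) ∷ ((3 , 6) , 1 , 13) ∷ ((6 , 4) , 0 , 12) ∷ ((9 , 2) , 0 , 12) ∷ ((1 , 7) , 0 , 12) ∷
  ((12 , 0) , 0 , 12) ∷ ((4 , 5) , 0 , 12) ∷ ((7 , 3) , 1 , 12) ∷ ((10 , 1) , 1 , 12) ∷ ((2 , 6) , 0 , 11) ∷
  ((5 , 4) , 0 , 11) ∷ ((8 , 2) , 0 , 11) ∷ ((0 , 7) , 1 , 11) ∷ ((11 , 0) , 0 , 10) ∷ ((3 , 5) , 0 , 10) ∷
  ((6 , 3) , 0 , 10) ∷ ((9 , 1) , 1 , 10) ∷ ((1 , 6) , 0 , 9) ∷ ((4 , 4) , 0 , 9) ∷ ((7 , 2) , 1 , 9) ∷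
  ((10 , 0) , 0 , 8) ∷ ((2 , 5) , 0 , 8) ∷ ((5 , 3) , 0 , 8) ∷ ((8 , 1) , 1 , 8) ∷ ((0 , 6) , 0 , 7) ∷
  ((3 , 4) , 1 , 7) ∷ ((6 , 2) , 0 , 6) ∷ ((9 , 0) , 0 , 6) ∷ ((1 , 5) , 0 , 6) ∷ ((4 , 3) , 1 , 6) ∷
  ((7 , 1) , 0 , 5) ∷ ((2 , 4) , 1 , 5) ∷ ((5 , 2) , 0 , 4) ∷ ((8 , 0) , 0 , 4) ∷ ((0 , 5) , 0 , 4) ∷
  ((3 , 3) , 1 , 4) ∷ ((6 , 1) , 0 , 3) ∷ ((1 , 4) , 1 , 3) ∷ ((4 , 2) , 0 , 2) ∷ ((7 , 0) , 0 , 2) ∷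
  ((2 , 3) , 1 , 2) ∷ ((5 , 1) , 0 , 1) ∷ ((0 , 4) , 0 , 1) ∷ ((3 , 2) , 1 , 1) ∷ ((6 , 0) , 0 , 1) ∷
  ((1 , 3) , 1 , 13) ∷ ((4 , 1) , 1 , 13) ∷ ((2 , 2) , 0 , 6) ∷ ((5 , 0) , 0 , 13) ∷ ((0 , 3) , 1 , 13) ∷
  ((3 , 1) , 1 , 8) ∷ ((1 , 2) , 0 , 0) ∷ ((4 , 0) , 0 , 0) ∷ ((2 , 1) , 1 , 0) ∷ ((0 , 2) , 0 , 0) ∷
  ((3 , 0) , 1 , 3) ∷ ((1 , 1) , 1 , 3) ∷ ((2 , 0) , 0 , 1) ∷ ((0 , 1) , 1 , 1) ∷ ((1 , 0) , 1 , 0) ∷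
  ((0 , 0) , 1 , 0) ∷ []

-- From certified densities to the limit

eventually : ∀ Q S c p q → Q * p + 1 ≤ q * S → ∀ N x → N * S ≤ Q * (x + c) → Q * q * c < N → p * N < q * x
eventually Q S c p q gap N x le large = *-cancelˡ-< Q (p * N) (q * x) (+-cancelʳ-< N (Q * (p * N)) (Q * (q * x)) (begin-strict
  Q * (p * N) + N           ≡⟨ e₁ Q p N ⟩
  (Q * p + 1) * N           ≤⟨ *-monoˡ-≤ N gap ⟩
  q * S * N                 ≡⟨ e₂ q S N ⟩
  q * (N * S)               ≤⟨ *-monoʳ-≤ q le ⟩
  q * (Q * (x + c))         ≡⟨ e₃ q Q x c ⟩
  -- The slack 1 in `gap` yields a whole `N`, which outweighs the constant offset once N > Q q c.
  Q * (q * x) + Q * q * c   <⟨ +-monoʳ-< (Q * (q * x)) large ⟩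
  Q * (q * x) + N           ∎))
  where
  open ≤-Reasoning
  e₁ : ∀ Q p N → Q * (p * N) + N ≡ (Q * p + 1) * N
  e₁ = solve-∀
  e₂ : ∀ q S N → q * S * N ≡ q * (N * S)
  e₂ = solve-∀
  e₃ : ∀ q Q x c → q * (Q * (x + c)) ≡ Q * (q * x) + Q * q * c
  e₃ = solve-∀

frac-+-< : ∀ a m b n c k → (a * suc n + b * suc m) * suc k < c * (suc m * suc n) → frac a m ℚ.+ frac b n ℚ.< frac c k
frac-+-< a m b n c k lt = <-frac (frac a m ℚ.+ frac b n) {c} {k} (ℚᵘ.<-respˡ-≃
  (ℚᵘ.≃-sym (ℚᵘ.≃-trans (ℚ.toℚᵘ-homo-+ (frac a m) (frac b n)) (ℚᵘ.+-cong (toℚᵘ-frac a m) (toℚᵘ-frac b n))))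
  (ℚᵘ.*<* (subst₂ ℤ._<_ (trans (ℤ.pos-* (a * suc n + b * suc m) (suc k))
    (cong (ℤ._* ℤ.+ suc k) (cong₂ ℤ._+_ (ℤ.pos-* a (suc n)) (ℤ.pos-* b (suc m))))) (ℤ.pos-* c (suc m * suc n)) (ℤ.+<+ lt))))

<-‿- : ∀ x y z → x ℚ.+ y ℚ.< z → x ℚ.< z ℚ.- y
<-‿- x y z lt = subst (ℚ._< z ℚ.- y)
  (trans (ℚ.+-assoc x y (ℚ.- y)) (trans (cong (x ℚ.+_) (ℚ.+-inverseʳ y)) (ℚ.+-identityʳ x)))
  (ℚ.+-monoˡ-< (ℚ.- y) lt)

-- `p / (suc m′ * suc k)` is 1 - a′ / suc m′ + b / suc k: a larger density of missing integers
-- pushes `g N / N` below the upper end by more than δ = b / suc k.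
between : ∀ (g : ℕ → ℕ) Q S₁ c₁ S₂ c₂ a m a′ m′ b k p →
  Q * (a * suc k + b * suc m) + 1 ≤ suc m * suc k * S₁ → (∀ N → N * S₁ ≤ Q * (g N + c₁)) →
  p + a′ * suc k ≡ suc m′ * suc k + b * suc m′ →
  Q * p + 1 ≤ suc m′ * suc k * S₂ → (∀ N → ∃[ r ] (g N + r ≡ N × N * S₂ ≤ Q * (r + c₂))) →
  ℚ.0ℚ ℚ.< frac b k → LimitStrictlyBetween (frac a m) (frac a′ m′) (ratio g)
between g Q S₁ c₁ S₂ c₂ a m a′ m′ b k p gap₁ lower p-eq gap₂ upper δ>0 =
  frac b k , δ>0 , Q * (suc m * suc k) * c₁ + Q * (suc m′ * suc k) * c₂ , λ n n₀≤n →
    frac-+-< a m b k (g (suc n)) n (above n (m+n≤o⇒m≤o _ n₀≤n)) ,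
    <-‿- (ratio g n) (frac b k) (frac a′ m′) (frac-+-< (g (suc n)) n b k a′ m′ (below n (m+n≤o⇒n≤o (Q * (suc m * suc k) * c₁) n₀≤n)))
  where
  above : ∀ n → Q * (suc m * suc k) * c₁ ≤ n → (a * suc k + b * suc m) * suc n < g (suc n) * (suc m * suc k)
  above n n₀≤n = subst ((a * suc k + b * suc m) * suc n <_) (*-comm (suc m * suc k) (g (suc n)))
    (eventually Q S₁ c₁ (a * suc k + b * suc m) (suc m * suc k) gap₁ (suc n) (g (suc n)) (lower (suc n)) (s≤s n₀≤n))
  below : ∀ n → Q * (suc m′ * suc k) * c₂ ≤ n → (g (suc n) * suc k + b * suc n) * suc m′ < a′ * (suc n * suc k)
  below n n₀≤n with upper (suc n)
  ... | r , eq , le = combine (suc n) (suc m′) (suc k) (g (suc n)) r eq p-eq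
        (eventually Q S₂ c₂ p (suc m′ * suc k) gap₂ (suc n) r le (s≤s n₀≤n))
    where
    combine : ∀ N M K x r → x + r ≡ N → p + a′ * K ≡ M * K + b * M → p * N < M * K * r → (x * K + b * N) * M < a′ * (N * K)
    combine N M K x r refl p-eq lt = +-cancelʳ-< (p * (x + r)) ((x * K + b * (x + r)) * M) (a′ * ((x + r) * K)) (begin-strict
      (x * K + b * (x + r)) * M + p * (x + r)           <⟨ +-monoʳ-< ((x * K + b * (x + r)) * M) lt ⟩
      (x * K + b * (x + r)) * M + M * K * r             ≡⟨ e₁ x K b r M ⟩
      (M * K + b * M) * (x + r)                         ≡⟨ cong (_* (x + r)) (sym p-eq) ⟩
      (p + a′ * K) * (x + r)                            ≡⟨ e₂ p a′ K (x + r) ⟩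
      a′ * ((x + r) * K) + p * (x + r)                  ∎)
      where
      open ≤-Reasoning
      e₁ : ∀ x K b r M → (x * K + b * (x + r)) * M + M * K * r ≡ (M * K + b * M) * (x + r)
      e₁ = solve-∀
      e₂ : ∀ p a K N → (p + a * K) * N ≡ a * (N * K) + p * N
      e₂ = solve-∀

grid-valid : AllValid grid-cert
grid-valid = Verify.verify-sound 27 216 strip (Verify.verify-sound 40 20 [] tt strip refl strip-verified) grid-cert refl grid-verified

open import Data.Integer using (+_)

theorem4p1 : (g : ℕ → ℕ) → ((N : ℕ) → IsG3 N (g N)) →
    Cauchy (ratio g)
    × LimitStrictlyBetween ((+ 790470) / 1000000) ((+ 791266) / 1000000) (ratio g)
theorem4p1 g G = cauchy (Increments.approximate g G) ,
  -- 19 is the largest exponent occurring in `grid-cert`, so 6¹⁹ is a common denominator for both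
  -- lists.
  between g (3 * smooth 19 19)
    (total (λ x → Lower.gain low-sets x * at (weight 19) (proj₁ x)) low-entries) (total (Lower.gain low-sets) low-entries)
    (total (λ x → miss x * at (weight 19) (proj₂ x)) grid-cert) (total miss grid-cert)
    -- Denominators are given by their predecessors. The margin is δ = 10⁻⁷, and the last number is
    -- (1 - 0.791266 + δ) · 10¹³.
    790470 999999 791266 999999 1 9999999 2087341000000
    (≤ᵇ≡⇒≤ refl) (Lower.lower low-sets G low-entries refl refl refl 19 refl)
    refl (≤ᵇ≡⇒≤ refl) (Upper.upper G grid-cert grid-valid refl 19 refl)
    (ℚ.positive⁻¹ (frac 1 9999999))
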